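{- Let $G$ be a finite group. (i) If $G\in\Psi$, then $\dim(\mathcal P_G)=|G|-|\mathcal U(G)|+1$. (ii) If $G\notin\Psi$, then $\dim(\mathcal P_G)=|G|-|\mathcal U(G)|+|W(G)|$.
   Context: $\mathcal P_G$ is the power graph of $G$ (vertex set $G$, distinct elements adjacent iff one is a power of the other), with graph distance $d_{\mathcal P_G}$. A resolving set of a connected graph $\Gamma$ is an ordered vertex set $W=(w_1,\dots,w_k)$ such that the vectors $(d(v,w_1),\dots,d(v,w_k))$ are distinct for distinct vertices $v$; $\dim(\Gamma)$ is the minimum size of a resolving set. $N(x)$, $N[x]$ are the open/closed neighbourhoods of $x$ in $\mathcal P_G$; $x\equiv y$ iff $N(x)=N(y)$ or $N[x]=N[y]$ (an equivalence relation), $\overline{x}$ is the class of $x$ and $\mathcal U(G)$ the set of classes. $R\{x,y\}=\{z\in G: d_{\mathcal P_G}(x,z)\ne d_{\mathcal P_G}(y,z)\}$. A resolving involution is an element $w$ of order $2$ for which there exist $x,y\in G\setminus\overline{w}$ with $R\{x,y\}=\{x,y,w\}$; $W(G)$ is the set of resolving involutions. $\Psi$ is the class of finite noncyclic groups $G$ for which there exists an odd prime $p$ such that: (C1) the prime divisors of $|G|$ are exactly $2$ and $p$; (C2) $G$ has a unique subgroup of order $p$; (C3) $G$ has no element of order $4$; (C4) every involution of $G$ is contained in a cyclic subgroup of order $2p$. -}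

module Defs where

open import Level using (0ℓ)
open import Data.Nat using (ℕ; zero; suc; _≤_; _<_; _*_)
open import Data.Nat.Divisibility using (_∣_)
open import Data.Nat.Primality using (Prime)
open import Data.Fin using (Fin)
open import Data.Fin.Subset using (Subset; _∈_; ∣_∣)
open import Data.Product using (Σ; ∃; ∃-syntax; _×_; _,_)
open import Data.Sum using (_⊎_)
open import Relation.Nullary using (¬_)
open import Relation.Binary.PropositionalEquality using (_≡_; _≢_)
open import Function.Bundles using (_⇔_)
open import Algebra.Structures using (IsGroup)

record FinGroup (n : ℕ) : Set where
  field
    _∙_     : Fin n → Fin n → Fin n
    ε       : Fin n
    _⁻¹     : Fin n → Fin n
    isGroup : IsGroup _≡_ _∙_ ε _⁻¹

module _ {n : ℕ} (G : FinGroup n) where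
  open FinGroup G

  El : Set
  El = Fin n

  pow : El → ℕ → El
  pow g zero    = ε
  pow g (suc k) = g ∙ pow g k

  HasOrder : El → ℕ → Set
  HasOrder g k = 0 < k × pow g k ≡ ε × (∀ j → 0 < j → pow g j ≡ ε → k ≤ j)

  IsInvolution : El → Set
  IsInvolution g = HasOrder g 2

  IsPowerOf : El → El → Set
  IsPowerOf y x = ∃[ k ] y ≡ pow x k

  Adj : El → El → Set
  Adj x y = x ≢ y × (IsPowerOf y x ⊎ IsPowerOf x y)

  data Walk : El → El → ℕ → Set where
    here : ∀ {x} → Walk x x 0
    step : ∀ {x y z m} → Adj x y → Walk y z m → Walk x z (suc m)

  IsDist : El → El → ℕ → Set
  IsDist x y m = Walk x y m × (∀ k → Walk x y k → m ≤ k)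

  Distinguishes : El → El → El → Set
  Distinguishes z x y = ¬ (∃[ m ] (IsDist x z m × IsDist y z m))

  -- resolving set (order of the elements is irrelevant for resolving)
  Resolving : Subset n → Set
  Resolving W = ∀ x y → x ≢ y → ∃[ w ] (w ∈ W × Distinguishes w x y)

  IsMetricDim : ℕ → Set
  IsMetricDim k = (∃[ W ] (Resolving W × ∣ W ∣ ≡ k))
                × (∀ W → Resolving W → k ≤ ∣ W ∣)

  SameOpenNbhd : El → El → Set
  SameOpenNbhd x y = ∀ z → (Adj x z ⇔ Adj y z)

  SameClosedNbhd : El → El → Set
  SameClosedNbhd x y = ∀ z → ((z ≡ x ⊎ Adj x z) ⇔ (z ≡ y ⊎ Adj y z))

  Twin : El → El → Set
  Twin x y = SameOpenNbhd x y ⊎ SameClosedNbhd x y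

  -- |U(G)| ≡ c : there is a complete system of c pairwise non-equivalent
  -- representatives of the classes
  NumClasses : ℕ → Set
  NumClasses c = ∃[ S ] ( ∣ S ∣ ≡ c
                        × (∀ x → ∃[ s ] (s ∈ S × Twin x s))
                        × (∀ s t → s ∈ S → t ∈ S → Twin s t → s ≡ t))

  IsResolvingInvolution : El → Set
  IsResolvingInvolution w =
    IsInvolution w ×
    ∃[ x ] ∃[ y ] ( ¬ Twin x w × ¬ Twin y w
                  × (∀ z → (Distinguishes z x y ⇔ (z ≡ x ⊎ z ≡ y ⊎ z ≡ w))))

  Card : (El → Set) → ℕ → Set
  Card P c = ∃[ S ] ((∀ x → (x ∈ S ⇔ P x)) × ∣ S ∣ ≡ c)

  Cyclic : Set
  Cyclic = ∃[ g ] (∀ x → IsPowerOf x g)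

  IsSubgroup : Subset n → Set
  IsSubgroup H = ε ∈ H
               × (∀ x y → x ∈ H → y ∈ H → (x ∙ y) ∈ H)
               × (∀ x → x ∈ H → (x ⁻¹) ∈ H)

  UniqueSubgroupOfOrder : ℕ → Set
  UniqueSubgroupOfOrder p =
    (∃[ H ] (IsSubgroup H × ∣ H ∣ ≡ p))
    × (∀ H K → IsSubgroup H → ∣ H ∣ ≡ p → IsSubgroup K → ∣ K ∣ ≡ p → H ≡ K)

  InΨ : Set
  InΨ = ¬ Cyclic ×
    ∃[ p ] ( Prime p × p ≢ 2
           × (∀ q → Prime q → (q ∣ n ⇔ (q ≡ 2 ⊎ q ≡ p)))
           × UniqueSubgroupOfOrder p
           × (∀ g → ¬ HasOrder g 4)
           × (∀ g → IsInvolution g → ∃[ h ] (HasOrder h (2 * p) × IsPowerOf g h)))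

{-# OPTIONS --safe #-}

-- Two vertices are separated by a third vertex z exactly when one of them is comparable to z (in the
-- order "is a power of") and the other is not. A resolving set therefore contains all but at most one
-- vertex of each twin class, and the question is which further vertices are forced. Vertices of order
-- at least 3 are twins of their inverses, so if the complement of a transversal T does not resolve
-- x, y ∈ T, then x and y are separated only by involutions forming their own class. If there is just
-- one, it is a resolving involution. If there are several, then since a cyclic group has at most one
-- involution, one of x, y is ε and the other is comparable to every non-involution, which forces G ∈ Ψ.
-- Conversely every resolving involution costs one extra vertex: the pairs {x, y} witnessing distinct
-- resolving involutions lie in disjoint sets of twin classes.
module Submission where

open import Defs
open import Algebra.Bundles using (Group)
import Algebra.Properties.Group as GroupProperties
open import Algebra.Structures using (IsGroup)
open import Data.Bool.Base using (Bool; true; false)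
import Data.Bool.Properties as Bool
open import Data.Fin.Base using (Fin; zero; suc; toℕ)
open import Data.Fin.Properties using (_≟_; pigeonhole; any?)
open import Data.Fin.Subset using (Subset; inside; outside; ∣_∣; ⁅_⁆; _∪_; ∁; _⊆_) renaming (_∈_ to _∈ₛ_; _∉_ to _∉ₛ_)
open import Data.Fin.Subset.Properties using (_∈?_; ∈⊤; ∣⊤∣≡n; ∣p∣≤n; p⊂q⇒∣p∣<∣q∣; ⊆-antisym; x∈∁p⇒x∉p; x∉∁p⇒x∈p; ∣∁p∣≡n∸∣p∣; x∈p∪q⁺; x∈⁅x⁆; x∈⁅y⁆⇒x≡y; ∣⁅x⁆∣≡1)
open import Data.List.Base using (List; []; _∷_; _++_; map; length; filter; foldr; replicate; applyUpTo; allFin; cartesianProductWith)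
open import Data.List.Membership.Propositional using (_∈_)
open import Data.List.Membership.Propositional.Properties
import Data.List.Membership.DecPropositional as DecMembership
open import Data.List.Properties using (length-map; length-++; length-applyUpTo; length-replicate; length-tabulate; ++-identityʳ; ++-assoc; ∷-injective; ∷-injectiveˡ; ∷-injectiveʳ; ≡-dec)
open import Data.List.Relation.Unary.All as All using ([]; _∷_)
open import Data.List.Relation.Unary.Any using (here; there)
open import Data.List.Relation.Unary.Unique.Propositional using (Unique; []; _∷_)
import Data.List.Relation.Unary.Unique.Propositional.Properties as Uniq
open import Data.Nat using (ℕ; zero; suc; pred; _+_; _*_; _∸_; _≤_; _<_; z≤n; s≤s; z<s; s≤s⁻¹; _<?_; NonZero; >-nonZero; >-nonZero⁻¹; ≢-nonZero; ≢-nonZero⁻¹; nonTrivial⇒n>1) renaming (_^_ to _^ℕ_; _≟_ to _≟ℕ_)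
open import Data.Nat.Coprimality using (Coprime; coprime-Bézout; prime⇒coprime)
open import Data.Nat.DivMod using (_%_; _/_; m≡m%n+[m/n]*n; m%n<n)
open import Data.Nat.Divisibility
open import Data.Nat.GCD using (module Bézout)
open import Data.Nat.Induction using (<-rec)
open import Data.Nat.Primality using (Prime; prime⇒nonZero; prime⇒nonTrivial; euclidsLemma; prime⇒irreducible; ¬prime[1]; prime[2])
open import Data.Nat.Primality.Factorisation using (factorise)
open import Data.Nat.Properties hiding (_≟_)
open import Data.Product using (∃-syntax; _×_; _,_; proj₁; proj₂; map₂)
open import Data.Sum using (_⊎_; inj₁; inj₂; fromInj₂)
open import Data.Vec.Base as Vec using ([]; _∷_; here; there)
open import Data.Vec.Properties using (lookup∘tabulate; lookup⇒[]=; []=⇒lookup)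
open import Function.Base using (_∘_)
open import Function.Bundles using (_⇔_; mk⇔; Equivalence)
open import Relation.Binary.Definitions using (DecidableEquality)
open import Relation.Binary.PropositionalEquality
open import Relation.Nullary using (¬_; Dec; does; yes; no; contradiction; ¬?; _×-dec_; _⊎-dec_)
open import Relation.Nullary.Decidable using (map′; dec-true; dec-false)

open Equivalence using (to; from)

-- For G in Ψ the constant 1 arises as follows. The vertex ε and an element x of order p are
-- separated only by involutions besides themselves, and in such a group every involution is a class
-- of its own. No particular involution need be forced, yet some whole class must lie in every
-- resolving set: that of ε, of x, or of an involution. One extra vertex is also enough: a
-- representative of ε if there are several involutions, the involution itself if there is only one.
-- The obstacle in the lower bound outside Ψ is the disjointness of the witness pairs. Two
-- involutions should end up below a common vertex, which is impossible; but ε is comparable to an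
-- involution without lying above it, so every case in which ε occurs needs its own argument, often
-- with a third involution. Ψ speaks of the prime divisors of |G|, while comparability controls only
-- the orders of elements. Cauchy's theorem links the two, and a conjugation argument yields the
-- cyclic subgroups demanded by (C4).

-- Primes and counting in finite sets

prime-divisor : ∀ m → m ≢ 0 → m ≢ 1 → ∃[ q ] (Prime q × q ∣ m)
prime-divisor zero m≢0 _ = contradiction refl m≢0
prime-divisor m@(suc _) _ m≢1 with factorise m
... | record { factors = [] ; isFactorisation = eq } = contradiction eq m≢1
... | record { factors = q ∷ qs ; isFactorisation = eq ; factorsPrime = q-prime ∷ _ } =
  q , q-prime , subst (q ∣_) (sym eq) (m∣m*n _)

prime∣prime : ∀ {p q} → Prime p → Prime q → p ∣ q → p ≡ q
prime∣prime p-prime q-prime p∣q with prime⇒irreducible q-prime p∣q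
... | inj₁ refl = contradiction p-prime ¬prime[1]
... | inj₂ p≡q = p≡q

even⊎odd : ∀ m → ∃[ k ] (m ≡ k + k ⊎ m ≡ suc (k + k))
even⊎odd zero = 0 , inj₁ refl
even⊎odd (suc m) with even⊎odd m
... | k , inj₁ refl = k , inj₂ refl
... | k , inj₂ refl = suc k , inj₁ (cong suc (sym (+-suc k k)))

module _ {A B : Set} (F : A → B → Set) where

  -- F is an injective multivalued map into ys; no choice of values is needed to count.
  length-≤-by-relation : ∀ {xs : List A} {ys : List B} → Unique xs →
    (∀ {x} → x ∈ xs → ∃[ y ] (y ∈ ys × F x y)) →
    (∀ {x x′ y} → x ∈ xs → x′ ∈ xs → F x y → F x′ y → x ≡ x′) →
    length xs ≤ length ys
  length-≤-by-relation [] _ _ = z≤n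
  length-≤-by-relation {x ∷ xs} (x∉xs ∷ xs!) image inj with image (here refl)
  ... | y , y∈ys , Fxy with ∈-∃++ y∈ys
  ...   | as , bs , refl = begin
    suc (length xs)               ≤⟨ s≤s (length-≤-by-relation xs! image′ (λ u v → inj (there u) (there v))) ⟩
    suc (length (as ++ bs))       ≡⟨ cong suc (length-++ as) ⟩
    suc (length as + length bs)   ≡⟨ +-suc (length as) (length bs) ⟨
    length as + suc (length bs)   ≡⟨ length-++ as ⟨
    length (as ++ y ∷ bs)         ∎
    where
    open ≤-Reasoning
    image′ : ∀ {z} → z ∈ xs → ∃[ t ] (t ∈ as ++ bs × F z t)
    image′ z∈xs with image (there z∈xs)
    ... | t , t∈ , Fzt with ∈-++⁻ as t∈
    ...   | inj₁ t∈as = t , ∈-++⁺ˡ t∈as , Fzt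
    ...   | inj₂ (here refl) = contradiction (inj (here refl) (there z∈xs) Fxy Fzt) (All.lookup x∉xs z∈xs)
    ...   | inj₂ (there t∈bs) = t , ∈-++⁺ʳ as t∈bs , Fzt

module _ {A : Set} where

  length-mono-⊆ : ∀ {xs ys : List A} → Unique xs → (∀ {z} → z ∈ xs → z ∈ ys) → length xs ≤ length ys
  length-mono-⊆ xs! xs⊆ys =
    length-≤-by-relation _≡_ xs! (λ x∈ → _ , xs⊆ys x∈ , refl) (λ { _ _ refl refl → refl })

  length-≡ : ∀ {xs ys : List A} → Unique xs → Unique ys →
             (∀ {z} → z ∈ xs → z ∈ ys) → (∀ {z} → z ∈ ys → z ∈ xs) → length xs ≡ length ys
  length-≡ xs! ys! xs⊆ys ys⊆xs = ≤-antisym (length-mono-⊆ xs! xs⊆ys) (length-mono-⊆ ys! ys⊆xs)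

elements : ∀ {n} → Subset n → List (Fin n)
elements [] = []
elements (inside ∷ p) = zero ∷ map suc (elements p)
elements (outside ∷ p) = map suc (elements p)

length-elements : ∀ {n} (p : Subset n) → length (elements p) ≡ ∣ p ∣
length-elements [] = refl
length-elements (inside ∷ p) = cong suc (trans (length-map suc (elements p)) (length-elements p))
length-elements (outside ∷ p) = trans (length-map suc (elements p)) (length-elements p)

∈-elements⁺ : ∀ {n} {p : Subset n} {x} → x ∈ₛ p → x ∈ elements p
∈-elements⁺ {p = inside ∷ p} here = here refl
∈-elements⁺ {p = inside ∷ p} (there x∈p) = there (∈-map⁺ suc (∈-elements⁺ x∈p))
∈-elements⁺ {p = outside ∷ p} (there x∈p) = ∈-map⁺ suc (∈-elements⁺ x∈p)

∈-elements⁻ : ∀ {n} (p : Subset n) {x} → x ∈ elements p → x ∈ₛ p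
∈-elements⁻ (inside ∷ p) (here refl) = here
∈-elements⁻ (inside ∷ p) (there x∈) with ∈-map⁻ suc x∈
... | _ , y∈ , refl = there (∈-elements⁻ p y∈)
∈-elements⁻ (outside ∷ p) x∈ with ∈-map⁻ suc x∈
... | _ , y∈ , refl = there (∈-elements⁻ p y∈)

elements-unique : ∀ {n} (p : Subset n) → Unique (elements p)
elements-unique [] = []
elements-unique (inside ∷ p) =
  All.tabulate (λ x∈ 0≡x → case-suc (∈-map⁻ suc x∈) 0≡x) ∷ Uniq.map⁺ (λ { refl → refl }) (elements-unique p)
  where
  case-suc : ∀ {x} → ∃[ y ] (y ∈ elements p × x ≡ suc y) → zero ≢ x
  case-suc (_ , _ , refl) ()
elements-unique (outside ∷ p) = Uniq.map⁺ (λ { refl → refl }) (elements-unique p)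

∣p∪q∣≡∣p∣+∣q∣ : ∀ {n} (p q : Subset n) → (∀ {x} → x ∈ₛ p → x ∉ₛ q) → ∣ p ∪ q ∣ ≡ ∣ p ∣ + ∣ q ∣
∣p∪q∣≡∣p∣+∣q∣ [] [] _ = refl
∣p∪q∣≡∣p∣+∣q∣ (inside ∷ p) (inside ∷ q) disj = contradiction here (disj here)
∣p∪q∣≡∣p∣+∣q∣ (inside ∷ p) (outside ∷ q) disj =
  cong suc (∣p∪q∣≡∣p∣+∣q∣ p q (λ x∈p x∈q → disj (there x∈p) (there x∈q)))
∣p∪q∣≡∣p∣+∣q∣ (outside ∷ p) (inside ∷ q) disj =
  trans (cong suc (∣p∪q∣≡∣p∣+∣q∣ p q (λ x∈p x∈q → disj (there x∈p) (there x∈q)))) (sym (+-suc ∣ p ∣ ∣ q ∣))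
∣p∪q∣≡∣p∣+∣q∣ (outside ∷ p) (outside ∷ q) disj =
  ∣p∪q∣≡∣p∣+∣q∣ p q (λ x∈p x∈q → disj (there x∈p) (there x∈q))

-- Iterates of a map and orbits of prime length

iter : {A : Set} → (A → A) → ℕ → A → A
iter σ zero x = x
iter σ (suc k) x = σ (iter σ k x)

module _ {A : Set} (σ : A → A) where

  iter-+ : ∀ j k x → iter σ (j + k) x ≡ iter σ j (iter σ k x)
  iter-+ zero k x = refl
  iter-+ (suc j) k x = cong σ (iter-+ j k x)

  iter-suc : ∀ k x → iter σ k (σ x) ≡ σ (iter σ k x)
  iter-suc zero x = refl
  iter-suc (suc k) x = cong σ (iter-suc k x)

  iter-*-fixed : ∀ {x} k j → iter σ k x ≡ x → iter σ (j * k) x ≡ x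
  iter-*-fixed k zero _ = refl
  iter-*-fixed {x} k (suc j) fix = begin
    iter σ (k + j * k) x          ≡⟨ iter-+ k (j * k) x ⟩
    iter σ k (iter σ (j * k) x)   ≡⟨ cong (iter σ k) (iter-*-fixed k j fix) ⟩
    iter σ k x                    ≡⟨ fix ⟩
    x                             ∎
    where open ≡-Reasoning

  -- Bézout comes as `1 + b * k ≡ a * j` or with `j` and `k` exchanged, so no negative iterate
  -- occurs and `σ` need not be invertible; the summand 1 is the single application of `σ`.
  coprime-iterates-fixed : ∀ {x j k} → Coprime j k → iter σ j x ≡ x → iter σ k x ≡ x → σ x ≡ x
  coprime-iterates-fixed {x} {j} {k} cop fixj fixk with coprime-Bézout cop
  ... | Bézout.Identity.+- a b eq = begin
    σ x                          ≡⟨ cong σ (iter-*-fixed k b fixk) ⟨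
    iter σ (1 + b * k) x         ≡⟨ cong (λ m → iter σ m x) eq ⟩
    iter σ (a * j) x             ≡⟨ iter-*-fixed j a fixj ⟩
    x                            ∎
    where open ≡-Reasoning
  ... | Bézout.Identity.-+ a b eq = begin
    σ x                          ≡⟨ cong σ (iter-*-fixed j a fixj) ⟨
    iter σ (1 + a * j) x         ≡⟨ cong (λ m → iter σ m x) eq ⟩
    iter σ (b * k) x             ≡⟨ iter-*-fixed k b fixk ⟩
    x                            ∎
    where open ≡-Reasoning

module Orbits {A : Set} (_≟ᴬ_ : DecidableEquality A) (σ : A → A) {q : ℕ} (q-prime : Prime q) where

  open DecMembership _≟ᴬ_ using () renaming (_∈?_ to _∈ₗ?_)

  orbit : A → List A
  orbit x = applyUpTo (λ i → iter σ i x) q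

  -- If the iterates `i < j` coincide, `q ∸ i` further steps show that `x` returns after `j ∸ i`
  -- steps. This number lies strictly between 0 and `q`, hence is coprime to `q`, and `σ` would fix
  -- `x`. Moving forward replaces cancelling `i` steps, which would need `σ` injective.
  orbit-unique : ∀ {x} → iter σ q x ≡ x → σ x ≢ x → Unique (orbit x)
  orbit-unique {x} period σx≢x = Uniq.applyUpTo⁺₁ _ q distinct
    where
    distinct : ∀ {i j} → i < j → j < q → iter σ i x ≢ iter σ j x
    distinct {i} {j} i<j j<q eq =
      σx≢x (coprime-iterates-fixed σ (prime⇒coprime q-prime ⦃ >-nonZero (m<n⇒0<n∸m i<j) ⦄ (≤-<-trans (m∸n≤m j i) j<q)) period returns)
      where
      open ≡-Reasoning
      q-i+j : (j ∸ i) + q ≡ (q ∸ i) + j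
      q-i+j = begin
        (j ∸ i) + q         ≡⟨ +-comm (j ∸ i) q ⟩
        q + (j ∸ i)         ≡⟨ +-∸-assoc q (<⇒≤ i<j) ⟨
        (q + j) ∸ i         ≡⟨ +-∸-comm j (<⇒≤ (<-trans i<j j<q)) ⟩
        (q ∸ i) + j         ∎
      returns : iter σ (j ∸ i) x ≡ x
      returns = begin
        iter σ (j ∸ i) x                  ≡⟨ cong (iter σ (j ∸ i)) period ⟨
        iter σ (j ∸ i) (iter σ q x)       ≡⟨ iter-+ σ (j ∸ i) q x ⟨
        iter σ ((j ∸ i) + q) x            ≡⟨ cong (λ m → iter σ m x) q-i+j ⟩
        iter σ ((q ∸ i) + j) x            ≡⟨ iter-+ σ (q ∸ i) j x ⟩
        iter σ (q ∸ i) (iter σ j x)       ≡⟨ cong (iter σ (q ∸ i)) eq ⟨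
        iter σ (q ∸ i) (iter σ i x)       ≡⟨ iter-+ σ (q ∸ i) i x ⟨
        iter σ ((q ∸ i) + i) x            ≡⟨ cong (λ m → iter σ m x) (m∸n+n≡m (<⇒≤ (<-trans i<j j<q))) ⟩
        iter σ q x                        ≡⟨ period ⟩
        x                                 ∎

  iter-∈-orbit : ∀ {x} → iter σ q x ≡ x → ∀ {y} → y ∈ orbit x → ∀ k → iter σ k y ∈ orbit x
  iter-∈-orbit period y∈ zero = y∈
  iter-∈-orbit {x} period y∈ (suc k) with ∈-applyUpTo⁻ (λ i → iter σ i x) (iter-∈-orbit period y∈ k)
  ... | i , i<q , eq with suc i <? q
  ...   | yes 1+i<q = subst (_∈ orbit x) (sym (cong σ eq)) (∈-applyUpTo⁺ (λ i → iter σ i x) 1+i<q)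
  ...   | no 1+i≮q = subst (_∈ orbit x) (sym (trans (cong σ eq) (trans (cong (λ m → iter σ m x) 1+i≡q) period)))
                       (∈-applyUpTo⁺ (λ i → iter σ i x) {i = 0} (≤-<-trans z≤n i<q))
    where
    1+i≡q : suc i ≡ q
    1+i≡q = ≤-antisym i<q (≮⇒≥ 1+i≮q)

  -- Removing the orbit of the head removes exactly `q` entries and leaves a list with the same
  -- properties. The bound `k` makes the recursion structural. The two applications are left
  -- translations of a subgroup and rotations of tuples.
  fixed-point-free⇒∣length : ∀ k (xs : List A) → length xs ≤ k → Unique xs →
    (∀ {x} → x ∈ xs → σ x ∈ xs) →
    (∀ {x} → x ∈ xs → iter σ q x ≡ x) →
    (∀ {x} → x ∈ xs → σ x ≢ x) →
    q ∣ length xs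
  fixed-point-free⇒∣length _ [] _ _ _ _ _ = q ∣0
  fixed-point-free⇒∣length (suc k) xs@(x ∷ tl) (s≤s len≤) xs! closed period free =
    subst (q ∣_) (sym length-xs) (∣m∣n⇒∣m+n ∣-refl (fixed-point-free⇒∣length k rest rest≤k rest! rest-closed
      (period ∘ proj₁ ∘ ∈-rest⁻) (free ∘ proj₁ ∘ ∈-rest⁻)))
    where
    outside? : ∀ z → Dec (¬ z ∈ orbit x)
    outside? z = ¬? (z ∈ₗ? orbit x)

    rest : List A
    rest = filter outside? xs

    ∈-rest⁻ : ∀ {z} → z ∈ rest → z ∈ xs × ¬ (z ∈ orbit x)
    ∈-rest⁻ = ∈-filter⁻ outside?

    rest! : Unique rest
    rest! = Uniq.filter⁺ outside? xs!

    periodₓ : iter σ q x ≡ x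
    periodₓ = period (here refl)

    orbit⊆xs : ∀ {z} → z ∈ orbit x → z ∈ xs
    orbit⊆xs z∈ with ∈-applyUpTo⁻ (λ i → iter σ i x) z∈
    ... | i , _ , refl = iterates i
      where
      iterates : ∀ i → iter σ i x ∈ xs
      iterates zero = here refl
      iterates (suc i) = closed (iterates i)

    -- If `σ z` were in the orbit, `q - 1` further steps inside the orbit would lead back to `z`.
    rest-closed : ∀ {z} → z ∈ rest → σ z ∈ rest
    rest-closed {z} z∈ = ∈-filter⁺ outside? (closed (proj₁ (∈-rest⁻ z∈))) (λ σz∈orbit →
      proj₂ (∈-rest⁻ z∈) (subst (_∈ orbit x) back (iter-∈-orbit periodₓ σz∈orbit (pred q))))
      where
      back : iter σ (pred q) (σ z) ≡ z
      back = trans (iter-suc σ (pred q) z)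
               (trans (cong (λ m → iter σ m z) (suc-pred q ⦃ prime⇒nonZero q-prime ⦄)) (period (proj₁ (∈-rest⁻ z∈))))

    length-xs : length xs ≡ q + length rest
    length-xs = begin
      length xs                       ≡⟨ length-≡ xs! (Uniq.++⁺ (orbit-unique periodₓ (free (here refl))) rest! (λ (u , v) → proj₂ (∈-rest⁻ v) u)) split join ⟩
      length (orbit x ++ rest)        ≡⟨ length-++ (orbit x) ⟩
      length (orbit x) + length rest  ≡⟨ cong (_+ length rest) (length-applyUpTo _ q) ⟩
      q + length rest                 ∎
      where
      open ≡-Reasoning
      split : ∀ {z} → z ∈ xs → z ∈ orbit x ++ rest
      split {z} z∈ with z ∈ₗ? orbit x
      ... | yes z∈o = ∈-++⁺ˡ z∈o
      ... | no z∉o = ∈-++⁺ʳ (orbit x) (∈-filter⁺ outside? z∈ z∉o)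
      join : ∀ {z} → z ∈ orbit x ++ rest → z ∈ xs
      join z∈ with ∈-++⁻ (orbit x) z∈
      ... | inj₁ z∈o = orbit⊆xs z∈o
      ... | inj₂ z∈r = proj₁ (∈-rest⁻ z∈r)

    rest≤k : length rest ≤ k
    rest≤k = s≤s⁻¹ (begin
      1 + length rest  ≤⟨ +-monoˡ-≤ (length rest) (>-nonZero⁻¹ q ⦃ prime⇒nonZero q-prime ⦄) ⟩
      q + length rest  ≡⟨ length-xs ⟨
      length xs        ≤⟨ s≤s len≤ ⟩
      suc k            ∎)
      where open ≤-Reasoning

-- Tuples and their cyclic rotation

length-cartesianProductWith : ∀ {A B C : Set} (f : A → B → C) xs ys →
  length (cartesianProductWith f xs ys) ≡ length xs * length ys
length-cartesianProductWith f [] ys = refl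
length-cartesianProductWith f (x ∷ xs) ys =
  trans (length-++ (map (f x) ys)) (cong₂ _+_ (length-map (f x) ys) (length-cartesianProductWith f xs ys))

rotate : {A : Set} → List A → List A
rotate [] = []
rotate (x ∷ xs) = xs ++ x ∷ []

length-rotate : ∀ {A : Set} (xs : List A) → length (rotate xs) ≡ length xs
length-rotate [] = refl
length-rotate (x ∷ xs) = trans (length-++ xs) (+-comm (length xs) 1)

rotate-++ : ∀ {A : Set} (xs ys : List A) → iter rotate (length xs) (xs ++ ys) ≡ ys ++ xs
rotate-++ [] ys = sym (++-identityʳ ys)
rotate-++ (x ∷ xs) ys = begin
  rotate (iter rotate (length xs) (x ∷ xs ++ ys))   ≡⟨ iter-suc rotate (length xs) (x ∷ xs ++ ys) ⟨
  iter rotate (length xs) ((xs ++ ys) ++ x ∷ [])    ≡⟨ cong (iter rotate (length xs)) (++-assoc xs ys (x ∷ [])) ⟩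
  iter rotate (length xs) (xs ++ ys ++ x ∷ [])      ≡⟨ rotate-++ xs (ys ++ x ∷ []) ⟩
  (ys ++ x ∷ []) ++ xs                              ≡⟨ ++-assoc ys (x ∷ []) xs ⟩
  ys ++ x ∷ xs                                      ∎
  where open ≡-Reasoning

rotate-period : ∀ {A : Set} (xs : List A) → iter rotate (length xs) xs ≡ xs
rotate-period xs = subst (λ ys → iter rotate (length xs) ys ≡ xs) (++-identityʳ xs) (rotate-++ xs [])

-- Comparing heads shows that `xs` begins with `x` again, and the equation of the tails has the same
-- shape.
rotate-fixed : ∀ {A : Set} (x : A) xs → xs ++ x ∷ [] ≡ x ∷ xs → xs ≡ replicate (length xs) x
rotate-fixed x [] _ = refl
rotate-fixed x (y ∷ ys) eq with ∷-injectiveˡ eq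
... | refl = cong (y ∷_) (rotate-fixed x ys (∷-injectiveʳ eq))

-- Decidable subsets and least witnesses

⊆∧∣∣≥⇒⊇ : ∀ {n} {p q : Subset n} → p ⊆ q → ∣ q ∣ ≤ ∣ p ∣ → q ⊆ p
⊆∧∣∣≥⇒⊇ {p = p} p⊆q ∣q∣≤∣p∣ {x} x∈q with x ∈? p
... | yes x∈p = x∈p
... | no x∉p = contradiction ∣q∣≤∣p∣ (<⇒≱ (p⊂q⇒∣p∣<∣q∣ (p⊆q , x , x∈q , x∉p)))

module _ {n : ℕ} {P : Fin n → Set} (P? : ∀ x → Dec (P x)) where

  fromDec : Subset n
  fromDec = Vec.tabulate (does ∘ P?)

  ∈-fromDec⁺ : ∀ {x} → P x → x ∈ₛ fromDec
  ∈-fromDec⁺ {x} Px = lookup⇒[]= x fromDec (trans (lookup∘tabulate (does ∘ P?) x) (dec-true (P? x) Px))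

  ∈-fromDec⁻ : ∀ {x} → x ∈ₛ fromDec → P x
  ∈-fromDec⁻ {x} x∈ with P? x | trans (sym (lookup∘tabulate (does ∘ P?) x)) ([]=⇒lookup x∈)
  ... | yes Px | _ = Px

least : ∀ {P : ℕ → Set} → (∀ k → Dec (P k)) → ∀ m → P m → ∃[ k ] (P k × (∀ j → P j → k ≤ j))
least {P} P? = <-rec _ step′
  where
  step′ : ∀ m → (∀ {i} → i < m → P i → ∃[ k ] (P k × (∀ j → P j → k ≤ j))) → P m → ∃[ k ] (P k × (∀ j → P j → k ≤ j))
  step′ m smaller Pm with anyUpTo? P? m
  ... | yes (i , i<m , Pi) = smaller i<m Pi
  ... | no none = m , Pm , λ j Pj → ≮⇒≥ (λ j<m → none (j , j<m , Pj))

-- Element orders, cyclic subgroups and involutions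

module PowerGraph {n : ℕ} (G : FinGroup n) where
  open FinGroup G using (ε; isGroup) renaming (_∙_ to infixl 7 _∙_; _⁻¹ to infix 9 _⁻¹)
  open IsGroup isGroup using (assoc; identityˡ; identityʳ; inverseˡ; inverseʳ)

  group : Group _ _
  group = record { isGroup = isGroup }

  open GroupProperties group using (∙-cancelˡ; ∙-cancelʳ; inverseʳ-unique; inverseˡ-unique; ⁻¹-involutive)

  infixr 8 _^_
  infix 4 _≼_

  _^_ : El G → ℕ → El G
  _^_ = pow G

  _≼_ : El G → El G → Set
  _≼_ = IsPowerOf G

  x^1≡x : ∀ x → x ^ 1 ≡ x
  x^1≡x = identityʳ

  ^-+ : ∀ x j k → x ^ (j + k) ≡ x ^ j ∙ x ^ k
  ^-+ x zero k = sym (identityˡ _)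
  ^-+ x (suc j) k = trans (cong (x ∙_) (^-+ x j k)) (sym (assoc x _ _))

  ε^ : ∀ k → ε ^ k ≡ ε
  ε^ zero = refl
  ε^ (suc k) = trans (identityˡ _) (ε^ k)

  ^-* : ∀ x j k → (x ^ j) ^ k ≡ x ^ (k * j)
  ^-* x j zero = refl
  ^-* x j (suc k) = trans (cong (x ^ j ∙_) (^-* x j k)) (sym (^-+ x j (k * j)))

  ^-*-ε : ∀ {x j} k → x ^ j ≡ ε → x ^ (k * j) ≡ ε
  ^-*-ε {x} {j} k eq = trans (sym (^-* x j k)) (trans (cong (_^ k) eq) (ε^ k))

  ≼-refl : ∀ {x} → x ≼ x
  ≼-refl {x} = 1 , sym (x^1≡x x)

  ≼-trans : ∀ {x y z} → x ≼ y → y ≼ z → x ≼ z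
  ≼-trans (j , refl) (k , refl) = j * k , ^-* _ k j

  ε≼ : ∀ x → ε ≼ x
  ε≼ x = 0 , refl

  ≼ε : ∀ {x} → x ≼ ε → x ≡ ε
  ≼ε (k , eq) = trans eq (ε^ k)

  torsion : ∀ x → ∃[ m ] (0 < m × x ^ m ≡ ε)
  torsion x with pigeonhole (n<1+n n) (λ i → x ^ toℕ i)
  ... | i , j , i<j , eq = toℕ j ∸ toℕ i , m<n⇒0<n∸m i<j , ∙-cancelˡ (x ^ toℕ i) _ _ (begin
    x ^ toℕ i ∙ x ^ (toℕ j ∸ toℕ i)   ≡⟨ ^-+ x (toℕ i) _ ⟨
    x ^ (toℕ i + (toℕ j ∸ toℕ i))     ≡⟨ cong (x ^_) (m+[n∸m]≡n (<⇒≤ i<j)) ⟩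
    x ^ toℕ j                         ≡⟨ eq ⟨
    x ^ toℕ i                         ≡⟨ identityʳ _ ⟨
    x ^ toℕ i ∙ ε                     ∎)
    where open ≡-Reasoning

  abstract
    order : ∀ x → ∃[ m ] HasOrder G x m
    order x with torsion x
    ... | t , 0<t , x^t≡ε with least (λ k → (0 <? k) ×-dec (x ^ k ≟ ε)) t (0<t , x^t≡ε)
    ... | m , (0<m , x^m≡ε) , min = m , 0<m , x^m≡ε , λ j 0<j eq → min j (0<j , eq)

  ^-% : ∀ {x m} .⦃ _ : NonZero m ⦄ → x ^ m ≡ ε → ∀ j → x ^ j ≡ x ^ (j % m)
  ^-% {x} {m} eq j = begin
    x ^ j                          ≡⟨ cong (x ^_) (m≡m%n+[m/n]*n j m) ⟩
    x ^ (j % m + j / m * m)        ≡⟨ ^-+ x (j % m) _ ⟩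
    x ^ (j % m) ∙ x ^ (j / m * m)  ≡⟨ cong (x ^ (j % m) ∙_) (^-*-ε (j / m) eq) ⟩
    x ^ (j % m) ∙ ε                ≡⟨ identityʳ _ ⟩
    x ^ (j % m)                    ∎
    where open ≡-Reasoning

  order∣ : ∀ {x m j} → HasOrder G x m → x ^ j ≡ ε → m ∣ j
  order∣ {x} {m} {j} (0<m , x^m≡ε , min) x^j≡ε with j % m in eq
    where instance _ = >-nonZero 0<m
  ... | zero = m%n≡0⇒n∣m j m ⦃ >-nonZero 0<m ⦄ eq
  ... | suc r = contradiction (min (suc r) z<s (trans (cong (x ^_) (sym eq)) (trans (sym (^-% x^m≡ε j)) x^j≡ε)))
                  (<⇒≱ (subst (_< m) eq (m%n<n j m)))
    where instance _ = >-nonZero 0<m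

  order-unique : ∀ {x j k} → HasOrder G x j → HasOrder G x k → j ≡ k
  order-unique oj@(_ , ej , _) ok@(_ , ek , _) = ∣-antisym (order∣ oj ek) (order∣ ok ej)

  order-≢0 : ∀ {x m} → HasOrder G x m → m ≢ 0
  order-≢0 (0<m , _) = >⇒≢ 0<m

  order-1 : ∀ {x} → HasOrder G x 1 → x ≡ ε
  order-1 {x} (_ , eq , _) = trans (sym (x^1≡x x)) eq

  order-^ : ∀ {x d e} → HasOrder G x (d * e) → HasOrder G (x ^ e) d
  order-^ {x} {zero} (() , _)
  order-^ {x} {suc d} {e} ox@(0<m , eq , _) = z<s , trans (^-* x e (suc d)) eq , λ j 0<j eqj →
    ∣⇒≤ ⦃ >-nonZero 0<j ⦄ (*-cancelʳ-∣ e ⦃ e-nonZero ⦄ (order∣ ox (trans (sym (^-* x e j)) eqj)))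
    where
    e-nonZero : NonZero e
    e-nonZero = ≢-nonZero (λ { refl → contradiction (*-zeroʳ d) (>⇒≢ 0<m) })

  element-of-order : ∀ {x m d} → HasOrder G x m → d ∣ m → ∃[ y ] (y ≼ x × HasOrder G y d)
  element-of-order {x} ox (divides e refl) =
    x ^ e , (e , refl) , order-^ (subst (HasOrder G x) (*-comm e _) ox)

  prime-order : ∀ {x q} → Prime q → x ≢ ε → x ^ q ≡ ε → HasOrder G x q
  prime-order {x} q-prime x≢ε x^q≡ε with order x
  ... | m , ox with prime⇒irreducible q-prime (order∣ ox x^q≡ε)
  ...   | inj₁ refl = contradiction (order-1 ox) x≢ε
  ...   | inj₂ refl = ox

  prime-order-≢ε : ∀ {x q} → Prime q → HasOrder G x q → x ≢ ε
  prime-order-≢ε q-prime (_ , _ , min) refl with min 1 z<s (identityʳ ε)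
  prime-order-≢ε {q = zero} _ (() , _) refl | _
  prime-order-≢ε {q = suc zero} q-prime _ refl | _ = ¬prime[1] q-prime
  prime-order-≢ε {q = suc (suc _)} _ _ refl | s≤s ()

  prime-order-element : ∀ {x} → x ≢ ε → ∃[ q ] ∃[ y ] (Prime q × y ≼ x × HasOrder G y q)
  prime-order-element {x} x≢ε with order x
  ... | m , ox with prime-divisor m (order-≢0 ox) (λ { refl → x≢ε (order-1 ox) })
  ...   | q , q-prime , q∣m with element-of-order ox q∣m
  ...     | y , y≼x , oy = q , y , q-prime , y≼x , oy

  abstract
    _≼?_ : ∀ y x → Dec (y ≼ x)
    y ≼? x with order x
    ... | m , 0<m , x^m≡ε , _ = map′ (λ (i , _ , eq) → i , eq)
        (λ (j , eq) → j % m , m%n<n j m , trans eq (^-% x^m≡ε j))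
        (anyUpTo? (λ i → y ≟ x ^ i) m)
      where
      instance
        m-nonZero : NonZero m
        m-nonZero = >-nonZero 0<m

  ⁻¹≼ : ∀ x → x ⁻¹ ≼ x
  ⁻¹≼ x with order x
  ... | suc m , _ , eq , _ = m , sym (inverseʳ-unique x (x ^ m) eq)

  ≼⁻¹ : ∀ x → x ≼ x ⁻¹
  ≼⁻¹ x = subst (_≼ x ⁻¹) (⁻¹-involutive x) (⁻¹≼ (x ⁻¹))

  mk-involution : ∀ {w} → w ≢ ε → w ∙ w ≡ ε → IsInvolution G w
  mk-involution {w} w≢ε ww≡ε = prime-order prime[2] w≢ε (trans (cong (w ∙_) (identityʳ w)) ww≡ε)

  involution-≢ε : ∀ {w} → IsInvolution G w → w ≢ ε
  involution-≢ε = prime-order-≢ε prime[2]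

  involution-square : ∀ {w} → IsInvolution G w → w ∙ w ≡ ε
  involution-square {w} (_ , eq , _) = trans (cong (w ∙_) (sym (identityʳ w))) eq

  abstract
    involution? : ∀ x → Dec (IsInvolution G x)
    involution? x = map′ (λ (a , b) → mk-involution a b) (λ i → involution-≢ε i , involution-square i)
      (¬? (x ≟ ε) ×-dec (x ∙ x ≟ ε))

  involution-^-even : ∀ {w} → IsInvolution G w → ∀ j → w ^ (j + j) ≡ ε
  involution-^-even {w} (_ , w²≡ε , _) j =
    trans (cong (w ^_) (sym (trans (*-comm j 2) (cong (j +_) (+-identityʳ j))))) (^-*-ε j w²≡ε)

  ≼-involution : ∀ {v w} → IsInvolution G w → v ≼ w → v ≡ ε ⊎ v ≡ w
  ≼-involution {w = w} iw (k , refl) with even⊎odd k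
  ... | j , inj₁ refl = inj₁ (involution-^-even iw j)
  ... | j , inj₂ refl = inj₂ (trans (cong (w ∙_) (involution-^-even iw j)) (identityʳ w))

  ≢⁻¹ : ∀ {x} → x ≢ ε → ¬ IsInvolution G x → x ⁻¹ ≢ x
  ≢⁻¹ {x} x≢ε ¬ix eq = ¬ix (mk-involution x≢ε (trans (cong (x ∙_) (sym eq)) (inverseʳ x)))

  ⁻¹-¬involution : ∀ {x} → x ≢ ε → ¬ IsInvolution G x → ¬ IsInvolution G (x ⁻¹)
  ⁻¹-¬involution {x} x≢ε ¬ix i with ≼-involution i (≼⁻¹ x)
  ... | inj₁ x≡ε = x≢ε x≡ε
  ... | inj₂ x≡x⁻¹ = ≢⁻¹ x≢ε ¬ix (sym x≡x⁻¹)

  -- With `u = g ^ i`, the order `m` divides `2 * i`, say `2 * i = k * m`. If `k` were even, `u`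
  -- would be a power of `g ^ m = ε`. So `m = h * 2` and `u = (g ^ h) ^ k`, a power of an element
  -- whose square is ε.
  involution-half : ∀ {u g m} → IsInvolution G u → u ≼ g → HasOrder G g m → ∃[ h ] (m ≡ h * 2 × u ≡ g ^ h)
  involution-half {u} {g} {m} iu (i , refl) og@(_ , g^m≡ε , _)
    with order∣ og (trans (sym (^-* g i 2)) (proj₁ (proj₂ iu)))
  ... | divides k 2i≡km with euclidsLemma k m prime[2] (divides i (trans (sym 2i≡km) (*-comm 2 i)))
  ...   | inj₁ (divides k′ refl) = contradiction
            (trans (cong (g ^_) (*-cancelˡ-≡ i (k′ * m) 2 (trans 2i≡km (trans (cong (_* m) (*-comm k′ 2)) (*-assoc 2 k′ m)))))
              (^-*-ε k′ g^m≡ε))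
            (involution-≢ε iu)
  ...   | inj₂ (divides h refl) = h , refl , trans u≡ (fromInj₂ (λ e → contradiction (trans u≡ e) (involution-≢ε iu)) g^h-power)
    where
    u≡ : g ^ i ≡ (g ^ h) ^ k
    u≡ = trans (cong (g ^_) (*-cancelˡ-≡ i (k * h) 2 (trans 2i≡km (trans (sym (*-assoc k h 2)) (*-comm (k * h) 2)))))
           (sym (^-* g h k))
    g^h-involution : g ^ h ≢ ε → IsInvolution G (g ^ h)
    g^h-involution ≢ε = prime-order prime[2] ≢ε (trans (^-* g h 2) (trans (cong (g ^_) (*-comm 2 h)) g^m≡ε))
    g^h-power : (g ^ h) ^ k ≡ ε ⊎ (g ^ h) ^ k ≡ g ^ h
    g^h-power with g ^ h ≟ ε
    ... | yes eq = inj₁ (trans (cong (_^ k) eq) (ε^ k))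
    ... | no ≢ε = ≼-involution (g^h-involution ≢ε) (k , refl)

  unique-involution : ∀ {u v g} → IsInvolution G u → IsInvolution G v → u ≼ g → v ≼ g → u ≡ v
  unique-involution {g = g} iu iv u≼g v≼g with order g
  ... | m , og with involution-half iu u≼g og | involution-half iv v≼g og
  ...   | h , refl , refl | h′ , eq , refl = cong (g ^_) (*-cancelʳ-≡ h h′ 2 eq)

  -- The product of the two if they commute, otherwise the conjugate of `w` by `v`. It refutes
  -- configurations containing ε, which is comparable to all involutions at once.
  third-involution : ∀ {v w} → IsInvolution G v → IsInvolution G w → v ≢ w →
                     ∃[ u ] (IsInvolution G u × u ≢ v × u ≢ w)
  third-involution {v} {w} iv iw v≢w with v ∙ w ≟ w ∙ v
  ... | yes vw≡wv = v ∙ w , mk-involution vw≢ε square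
        , (λ eq → involution-≢ε iw (∙-cancelˡ v w ε (trans eq (sym (identityʳ v)))))
        , (λ eq → involution-≢ε iv (∙-cancelʳ w v ε (trans eq (sym (identityˡ w)))))
    where
    open ≡-Reasoning
    vw≢ε : v ∙ w ≢ ε
    vw≢ε eq = v≢w (∙-cancelʳ w v w (trans eq (sym (involution-square iw))))
    square : (v ∙ w) ∙ (v ∙ w) ≡ ε
    square = begin
      (v ∙ w) ∙ (v ∙ w)   ≡⟨ cong ((v ∙ w) ∙_) vw≡wv ⟩
      (v ∙ w) ∙ (w ∙ v)   ≡⟨ assoc v w (w ∙ v) ⟩
      v ∙ (w ∙ (w ∙ v))   ≡⟨ cong (v ∙_) (assoc w w v) ⟨
      v ∙ ((w ∙ w) ∙ v)   ≡⟨ cong (λ z → v ∙ (z ∙ v)) (involution-square iw) ⟩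
      v ∙ (ε ∙ v)         ≡⟨ cong (v ∙_) (identityˡ v) ⟩
      v ∙ v               ≡⟨ involution-square iv ⟩
      ε                   ∎
  ... | no vw≢wv = u , mk-involution u≢ε square , u≢v , u≢w
    where
    open ≡-Reasoning
    u = v ∙ (w ∙ v)
    vv = involution-square iv
    vu : v ∙ u ≡ w ∙ v
    vu = begin
      v ∙ (v ∙ (w ∙ v))   ≡⟨ assoc v v (w ∙ v) ⟨
      (v ∙ v) ∙ (w ∙ v)   ≡⟨ cong (_∙ (w ∙ v)) vv ⟩
      ε ∙ (w ∙ v)         ≡⟨ identityˡ (w ∙ v) ⟩
      w ∙ v               ∎
    square : u ∙ u ≡ ε
    square = begin
      (v ∙ (w ∙ v)) ∙ u   ≡⟨ assoc v (w ∙ v) u ⟩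
      v ∙ ((w ∙ v) ∙ u)   ≡⟨ cong (v ∙_) (assoc w v u) ⟩
      v ∙ (w ∙ (v ∙ u))   ≡⟨ cong (λ z → v ∙ (w ∙ z)) vu ⟩
      v ∙ (w ∙ (w ∙ v))   ≡⟨ cong (v ∙_) (assoc w w v) ⟨
      v ∙ ((w ∙ w) ∙ v)   ≡⟨ cong (λ z → v ∙ (z ∙ v)) (involution-square iw) ⟩
      v ∙ (ε ∙ v)         ≡⟨ cong (v ∙_) (identityˡ v) ⟩
      v ∙ v               ≡⟨ vv ⟩
      ε                   ∎
    u≢ε : u ≢ ε
    u≢ε eq = involution-≢ε iw (∙-cancelʳ v w ε (trans (∙-cancelˡ v (w ∙ v) v (trans eq (sym vv))) (sym (identityˡ v))))
    u≢v : u ≢ v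
    u≢v eq = v≢w (sym (∙-cancelʳ v w v (trans (∙-cancelˡ v (w ∙ v) ε (trans eq (sym (identityʳ v)))) (sym vv))))
    u≢w : u ≢ w
    u≢w eq = vw≢wv (trans (cong (v ∙_) (sym eq)) vu)

  -- Subgroups

  subgroup-^ : ∀ {H} → IsSubgroup G H → ∀ {x} → x ∈ₛ H → ∀ k → x ^ k ∈ₛ H
  subgroup-^ (ε∈H , _) x∈H zero = ε∈H
  subgroup-^ sub@(_ , closed , _) x∈H (suc k) = closed _ _ x∈H (subgroup-^ sub x∈H k)

  subgroup-≼ : ∀ {H} → IsSubgroup G H → ∀ {x y} → x ∈ₛ H → y ≼ x → y ∈ₛ H
  subgroup-≼ sub x∈H (k , refl) = subgroup-^ sub x∈H k

  iter-∙ : ∀ h k x → iter (h ∙_) k x ≡ h ^ k ∙ x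
  iter-∙ h zero x = sym (identityˡ x)
  iter-∙ h (suc k) x = trans (cong (h ∙_) (iter-∙ h k x)) (sym (assoc h (h ^ k) x))

  -- Left translation by `h` permutes `H` without fixed points and has period `q`.
  prime-order∣subgroup : ∀ {h q H} → Prime q → HasOrder G h q → IsSubgroup G H → h ∈ₛ H → q ∣ ∣ H ∣
  prime-order∣subgroup {h} {q} {H} q-prime oh (_ , closed , _) h∈H =
    subst (q ∣_) (length-elements H)
      (fixed-point-free⇒∣length _ (elements H) ≤-refl (elements-unique H)
        (λ x∈ → ∈-elements⁺ (closed _ _ h∈H (∈-elements⁻ H x∈)))
        (λ {x} _ → trans (iter-∙ h q x) (trans (cong (_∙ x) (proj₁ (proj₂ oh))) (identityˡ x)))
        (λ {x} _ hx≡x → prime-order-≢ε q-prime oh (∙-cancelʳ x h ε (trans hx≡x (sym (identityˡ x))))))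
    where open Orbits _≟_ (h ∙_) q-prime

  prime-order∣n : ∀ {h q} → Prime q → HasOrder G h q → q ∣ n
  prime-order∣n {q = q} q-prime oh = subst (q ∣_) (∣⊤∣≡n n)
    (prime-order∣subgroup q-prime oh (∈⊤ , (λ _ _ _ _ → ∈⊤) , (λ _ _ → ∈⊤)) ∈⊤)

  ⟨_⟩ : El G → Subset n
  ⟨ x ⟩ = fromDec (_≼? x)

  ⟨⟩-subgroup : ∀ x → IsSubgroup G ⟨ x ⟩
  ⟨⟩-subgroup x =
    ∈-fromDec⁺ (_≼? x) (ε≼ x) ,
    (λ y z y∈ z∈ → ∈-fromDec⁺ (_≼? x) (product (∈-fromDec⁻ (_≼? x) y∈) (∈-fromDec⁻ (_≼? x) z∈))) ,
    (λ y y∈ → ∈-fromDec⁺ (_≼? x) (≼-trans (⁻¹≼ y) (∈-fromDec⁻ (_≼? x) y∈)))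
    where
    product : ∀ {y z} → y ≼ x → z ≼ x → y ∙ z ≼ x
    product (j , refl) (k , refl) = j + k , sym (^-+ x j k)

  ∣⟨⟩∣ : ∀ {x m} → HasOrder G x m → ∣ ⟨ x ⟩ ∣ ≡ m
  ∣⟨⟩∣ {x} {m} ox@(0<m , x^m≡ε , min) = begin
    ∣ ⟨ x ⟩ ∣                        ≡⟨ length-elements ⟨ x ⟩ ⟨
    length (elements ⟨ x ⟩)          ≡⟨ length-≡ (elements-unique ⟨ x ⟩) (Uniq.applyUpTo⁺₁ (x ^_) m distinct) powers⁺ powers⁻ ⟩
    length (applyUpTo (x ^_) m)      ≡⟨ length-applyUpTo (x ^_) m ⟩
    m                                ∎
    where
    open ≡-Reasoning
    instance _ = >-nonZero 0<m
    distinct : ∀ {i j} → i < j → j < m → x ^ i ≢ x ^ j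
    distinct {i} {j} i<j j<m eq = <⇒≱ (≤-<-trans (m∸n≤m j i) j<m)
      (min (j ∸ i) (m<n⇒0<n∸m i<j) (∙-cancelˡ (x ^ i) _ _ (begin
        x ^ i ∙ x ^ (j ∸ i)   ≡⟨ ^-+ x i (j ∸ i) ⟨
        x ^ (i + (j ∸ i))     ≡⟨ cong (x ^_) (m+[n∸m]≡n (<⇒≤ i<j)) ⟩
        x ^ j                 ≡⟨ eq ⟨
        x ^ i                 ≡⟨ identityʳ _ ⟨
        x ^ i ∙ ε             ∎)))
    powers⁺ : ∀ {z} → z ∈ elements ⟨ x ⟩ → z ∈ applyUpTo (x ^_) m
    powers⁺ z∈ with ∈-fromDec⁻ (_≼? x) (∈-elements⁻ ⟨ x ⟩ z∈)
    ... | j , refl = subst (_∈ applyUpTo (x ^_) m) (sym (^-% x^m≡ε j)) (∈-applyUpTo⁺ (x ^_) (m%n<n j m))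
    powers⁻ : ∀ {z} → z ∈ applyUpTo (x ^_) m → z ∈ elements ⟨ x ⟩
    powers⁻ z∈ with ∈-applyUpTo⁻ (x ^_) z∈
    ... | j , _ , refl = ∈-elements⁺ (∈-fromDec⁺ (_≼? x) (j , refl))

  -- The inclusion of `⟨ y ⟩` in `⟨ x ⟩` is one between sets of the same size `m`.
  ≼-sym-of-order : ∀ {x y m} → HasOrder G x m → HasOrder G y m → y ≼ x → x ≼ y
  ≼-sym-of-order {x} {y} ox oy y≼x = ∈-fromDec⁻ (_≼? y) (⊆∧∣∣≥⇒⊇ ⟨y⟩⊆⟨x⟩
      (≤-reflexive (trans (∣⟨⟩∣ ox) (sym (∣⟨⟩∣ oy)))) (∈-fromDec⁺ (_≼? x) ≼-refl))
    where
    ⟨y⟩⊆⟨x⟩ : ⟨ y ⟩ ⊆ ⟨ x ⟩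
    ⟨y⟩⊆⟨x⟩ z∈ = ∈-fromDec⁺ (_≼? x) (≼-trans (∈-fromDec⁻ (_≼? y) z∈) y≼x)

  -- Some power of a nontrivial element of `H` has prime order, and this prime divides `p`.
  element-of-prime-subgroup : ∀ {H p} → Prime p → IsSubgroup G H → ∣ H ∣ ≡ p → ∃[ h ] (h ∈ₛ H × HasOrder G h p)
  element-of-prime-subgroup {H} {p} p-prime sub refl with any? (λ x → (x ∈? H) ×-dec ¬? (x ≟ ε))
  ... | no none = contradiction small (<⇒≱ (nonTrivial⇒n>1 ∣ H ∣ ⦃ prime⇒nonTrivial p-prime ⦄))
    where
    only-ε : ∀ {x} → x ∈ elements H → x ∈ (ε ∷ [])
    only-ε {x} x∈ with x ≟ ε
    ... | yes x≡ε = here x≡ε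
    ... | no x≢ε = contradiction (x , ∈-elements⁻ H x∈ , x≢ε) none
    small : ∣ H ∣ ≤ 1
    small = subst (_≤ 1) (length-elements H) (length-mono-⊆ (elements-unique H) only-ε)
  ... | yes (x , x∈H , x≢ε) with prime-order-element x≢ε
  ...   | q , h , q-prime , h≼x , oh =
    h , h∈H , subst (HasOrder G h) (prime∣prime q-prime p-prime (prime-order∣subgroup q-prime oh sub h∈H)) oh
    where
    h∈H : h ∈ₛ H
    h∈H = subgroup-≼ sub x∈H h≼x

  -- Cauchy's theorem

  prod : List (El G) → El G
  prod = foldr _∙_ ε

  words : ℕ → List (List (El G))
  words zero = [] ∷ []
  words (suc k) = cartesianProductWith _∷_ (allFin n) (words k)

  length-words : ∀ k → length (words k) ≡ n ^ℕ k
  length-words zero = refl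
  length-words (suc k) = trans (length-cartesianProductWith _∷_ (allFin n) (words k))
    (cong₂ _*_ (length-tabulate {n = n} (λ i → i)) (length-words k))

  words-unique : ∀ k → Unique (words k)
  words-unique zero = [] ∷ []
  words-unique (suc k) = Uniq.cartesianProductWith⁺ _∷_ ∷-injective (Uniq.allFin⁺ n) (words-unique k)

  ∈-words⁺ : ∀ xs → xs ∈ words (length xs)
  ∈-words⁺ [] = here refl
  ∈-words⁺ (x ∷ xs) = ∈-cartesianProductWith⁺ _∷_ (∈-allFin x) (∈-words⁺ xs)

  ∈-words⁻ : ∀ k {xs} → xs ∈ words k → length xs ≡ k
  ∈-words⁻ zero (here refl) = refl
  ∈-words⁻ (suc k) xs∈ with ∈-cartesianProductWith⁻ _∷_ (allFin n) (words k) xs∈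
  ... | _ , _ , _ , ys∈ , refl = cong suc (∈-words⁻ k ys∈)

  -- The tuples of length `k + 1` with product ε: the first entry is determined by the others, which
  -- are arbitrary, so there are `n ^ℕ k` of them.
  relators : ℕ → List (List (El G))
  relators k = map (λ xs → prod xs ⁻¹ ∷ xs) (words k)

  relators-unique : ∀ k → Unique (relators k)
  relators-unique k = Uniq.map⁺ ∷-injectiveʳ (words-unique k)

  ∈-relators⁺ : ∀ {k xs} → length xs ≡ suc k → prod xs ≡ ε → xs ∈ relators k
  ∈-relators⁺ {xs = x ∷ xs} refl eq = subst (λ y → y ∷ xs ∈ relators (length xs))
    (sym (inverseˡ-unique x (prod xs) eq)) (∈-map⁺ _ (∈-words⁺ xs))

  ∈-relators⁻ : ∀ k {xs} → xs ∈ relators k → length xs ≡ suc k × prod xs ≡ ε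
  ∈-relators⁻ k xs∈ with ∈-map⁻ _ xs∈
  ... | ys , ys∈ , refl = cong suc (∈-words⁻ k ys∈) , inverseˡ (prod ys)

  prod-++ : ∀ xs ys → prod (xs ++ ys) ≡ prod xs ∙ prod ys
  prod-++ [] ys = sym (identityˡ _)
  prod-++ (x ∷ xs) ys = trans (cong (x ∙_) (prod-++ xs ys)) (sym (assoc x _ _))

  prod-rotate : ∀ xs → prod xs ≡ ε → prod (rotate xs) ≡ ε
  prod-rotate [] eq = eq
  prod-rotate (x ∷ xs) eq = begin
    prod (xs ++ x ∷ [])      ≡⟨ prod-++ xs (x ∷ []) ⟩
    prod xs ∙ (x ∙ ε)        ≡⟨ cong₂ _∙_ (inverseʳ-unique x (prod xs) eq) (identityʳ x) ⟩
    x ⁻¹ ∙ x                 ≡⟨ inverseˡ x ⟩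
    ε                        ∎
    where open ≡-Reasoning

  prod-replicate : ∀ k x → prod (replicate k x) ≡ x ^ k
  prod-replicate zero x = refl
  prod-replicate (suc k) x = cong (x ∙_) (prod-replicate k x)

  -- McKay: rotate the q-tuples with product ε; the fixed ones are the constant tuples (x,…,x) with x^q = ε.
  cauchy : ∀ {q} → Prime q → q ∣ n → ∃[ x ] HasOrder G x q
  cauchy {zero} q-prime _ = contradiction refl (≢-nonZero⁻¹ 0 ⦃ prime⇒nonZero q-prime ⦄)
  cauchy {suc zero} q-prime _ = contradiction q-prime ¬prime[1]
  cauchy {q@(suc (suc r))} q-prime q∣n with any? (λ x → ¬? (x ≟ ε) ×-dec (x ^ q ≟ ε))
  ... | yes (x , x≢ε , x^q≡ε) = x , prime-order q-prime x≢ε x^q≡ε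
  ... | no none = contradiction (∣1⇒≡1 q∣1) λ ()
    where
    trivial : List (El G)
    trivial = replicate q ε

    nontrivial? : ∀ xs → Dec (xs ≢ trivial)
    nontrivial? xs = ¬? (≡-dec _≟_ xs trivial)

    rest : List (List (El G))
    rest = filter nontrivial? (relators (suc r))

    ∈-rest⁻ : ∀ {xs} → xs ∈ rest → (length xs ≡ q × prod xs ≡ ε) × xs ≢ trivial
    ∈-rest⁻ xs∈ with ∈-filter⁻ nontrivial? xs∈
    ... | xs∈rel , xs≢ = ∈-relators⁻ (suc r) xs∈rel , xs≢

    ∈-rest⁺ : ∀ {xs} → length xs ≡ q → prod xs ≡ ε → xs ≢ trivial → xs ∈ rest
    ∈-rest⁺ len eq xs≢ = ∈-filter⁺ nontrivial? (∈-relators⁺ len eq) xs≢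

    fixed⇒trivial : ∀ xs → length xs ≡ q → prod xs ≡ ε → rotate xs ≡ xs → xs ≡ trivial
    fixed⇒trivial (x ∷ xs) len prod≡ε fix with rotate-fixed x xs fix
    ... | xs≡ with x ≟ ε
    ...   | yes refl = cong (ε ∷_) (trans xs≡ (cong (λ k → replicate k ε) (suc-injective len)))
    ...   | no x≢ε = contradiction (x , x≢ε , x^q≡ε) none
      where
      open ≡-Reasoning
      x^q≡ε : x ^ q ≡ ε
      x^q≡ε = begin
        x ^ q                          ≡⟨ cong (x ^_) len ⟨
        x ∙ x ^ length xs              ≡⟨ cong (x ∙_) (prod-replicate (length xs) x) ⟨
        x ∙ prod (replicate (length xs) x) ≡⟨ cong (λ ys → x ∙ prod ys) xs≡ ⟨
        x ∙ prod xs                    ≡⟨ prod≡ε ⟩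
        ε                              ∎

    rest-rotate : ∀ {xs} → xs ∈ rest → rotate xs ∈ rest
    rest-rotate {xs} xs∈ with ∈-rest⁻ xs∈
    ... | (len , eq) , xs≢ = ∈-rest⁺ (trans (length-rotate xs) len) (prod-rotate xs eq) (λ rot≡ → xs≢ (begin
      xs                                    ≡⟨ rotate-period xs ⟨
      iter rotate (length xs) xs            ≡⟨ cong (λ k → iter rotate k xs) len ⟩
      rotate (iter rotate (suc r) xs)       ≡⟨ iter-suc rotate (suc r) xs ⟨
      iter rotate (suc r) (rotate xs)       ≡⟨ cong (iter rotate (suc r)) (trans rot≡ (sym rotate-trivial)) ⟩
      iter rotate (suc r) (rotate trivial)  ≡⟨ iter-suc rotate (suc r) trivial ⟩
      iter rotate q trivial                 ≡⟨ cong (λ k → iter rotate k trivial) (length-replicate q) ⟨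
      iter rotate (length trivial) trivial  ≡⟨ rotate-period trivial ⟩
      trivial                               ∎))
      where
      open ≡-Reasoning
      replicate-snoc : ∀ k → replicate k ε ++ ε ∷ [] ≡ ε ∷ replicate k ε
      replicate-snoc zero = refl
      replicate-snoc (suc k) = cong (ε ∷_) (replicate-snoc k)
      rotate-trivial : rotate trivial ≡ trivial
      rotate-trivial = replicate-snoc (suc r)

    q∣rest : q ∣ length rest
    q∣rest = fixed-point-free⇒∣length _ rest ≤-refl (Uniq.filter⁺ nontrivial? (relators-unique (suc r)))
      rest-rotate
      (λ {xs} xs∈ → subst (λ k → iter rotate k xs ≡ xs) (proj₁ (proj₁ (∈-rest⁻ xs∈))) (rotate-period xs))
      (λ {xs} xs∈ fix → let ((len , eq) , xs≢) = ∈-rest⁻ xs∈ in xs≢ (fixed⇒trivial xs len eq fix))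
      where open Orbits (≡-dec _≟_) rotate q-prime

    length-relators : n ^ℕ suc r ≡ 1 + length rest
    length-relators = begin
      n ^ℕ suc r                   ≡⟨ length-words (suc r) ⟨
      length (words (suc r))       ≡⟨ length-map _ (words (suc r)) ⟨
      length (relators (suc r))    ≡⟨ length-≡ (relators-unique (suc r)) unique split join ⟩
      length (trivial ∷ rest)      ∎
      where
      open ≡-Reasoning
      unique : Unique (trivial ∷ rest)
      unique = All.tabulate (λ xs∈ eq → proj₂ (∈-rest⁻ xs∈) (sym eq))
             ∷ Uniq.filter⁺ nontrivial? (relators-unique (suc r))
      split : ∀ {xs} → xs ∈ relators (suc r) → xs ∈ trivial ∷ rest
      split {xs} xs∈ with ≡-dec _≟_ xs trivial
      ... | yes eq = here eq
      ... | no neq = there (∈-filter⁺ nontrivial? xs∈ neq)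
      join : ∀ {xs} → xs ∈ trivial ∷ rest → xs ∈ relators (suc r)
      join (here refl) = ∈-relators⁺ (length-replicate q) (trans (prod-replicate q ε) (ε^ q))
      join (there xs∈) = proj₁ (∈-filter⁻ nontrivial? xs∈)

    q∣1 : q ∣ 1
    q∣1 = ∣m+n∣m⇒∣n (subst (q ∣_) (trans length-relators (+-comm 1 (length rest))) (∣m⇒∣m*n (n ^ℕ r) q∣n)) q∣rest

-- Comparability, distances and twin classes

≢⇒true⊎true : ∀ {a b : Bool} → a ≢ b → (a ≡ true × b ≡ false) ⊎ (b ≡ true × a ≡ false)
≢⇒true⊎true {true} {true} a≢b = contradiction refl a≢b
≢⇒true⊎true {true} {false} _ = inj₁ (refl , refl)
≢⇒true⊎true {false} {true} _ = inj₂ (refl , refl)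
≢⇒true⊎true {false} {false} a≢b = contradiction refl a≢b

module Twins {n : ℕ} (G : FinGroup n) where
  open FinGroup G using (ε; _⁻¹)
  open PowerGraph G

  Comparable : El G → El G → Set
  Comparable x y = y ≼ x ⊎ x ≼ y

  abstract
    comparable? : ∀ x y → Dec (Comparable x y)
    comparable? x y = (y ≼? x) ⊎-dec (x ≼? y)

  -- Boolean-valued, so that "z does not separate x and y" is an equation and can be chained with
  -- others.
  c : El G → El G → Bool
  c x y = does (comparable? x y)

  c⁺ : ∀ {x y} → Comparable x y → c x y ≡ true
  c⁺ {x} {y} = dec-true (comparable? x y)

  c⁻ : ∀ {x y} → c x y ≡ true → Comparable x y
  c⁻ {x} {y} eq with comparable? x y | eq
  ... | yes xy | _ = xy

  c-false⁺ : ∀ {x y} → ¬ Comparable x y → c x y ≡ false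
  c-false⁺ {x} {y} = dec-false (comparable? x y)

  c-false⁻ : ∀ {x y} → c x y ≡ false → ¬ Comparable x y
  c-false⁻ eq xy with () ← trans (sym (c⁺ xy)) eq

  transfer : ∀ {x y z} → c x z ≡ c y z → Comparable x z → Comparable y z
  transfer eq xz = c⁻ (trans (sym eq) (c⁺ xz))

  c-≡ : ∀ {x y z} → (Comparable x z → Comparable y z) → (Comparable y z → Comparable x z) → c x z ≡ c y z
  c-≡ {x} {y} {z} xz⇒yz yz⇒xz with comparable? x z
  ... | yes xz = sym (c⁺ (xz⇒yz xz))
  ... | no ¬xz = sym (c-false⁺ (λ yz → ¬xz (yz⇒xz yz)))

  c-≢ : ∀ {x y z} → c x z ≢ c y z → (Comparable x z × ¬ Comparable y z) ⊎ (Comparable y z × ¬ Comparable x z)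
  c-≢ ne with ≢⇒true⊎true ne
  ... | inj₁ (t , f) = inj₁ (c⁻ t , c-false⁻ f)
  ... | inj₂ (t , f) = inj₂ (c⁻ t , c-false⁻ f)

  comparable-sym : ∀ {x y} → Comparable x y → Comparable y x
  comparable-sym (inj₁ y≼x) = inj₂ y≼x
  comparable-sym (inj₂ x≼y) = inj₁ x≼y

  c-sym : ∀ x y → c x y ≡ c y x
  c-sym x y with comparable? x y
  ... | yes xy = sym (c⁺ (comparable-sym xy))
  ... | no ¬xy = sym (c-false⁺ (λ yx → ¬xy (comparable-sym yx)))

  ε-comparable : ∀ x → Comparable ε x
  ε-comparable x = inj₂ (ε≼ x)

  -- Distances are 0, 1 or 2, since ε is adjacent to every other vertex.

  dist-0 : ∀ x → IsDist G x x 0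
  dist-0 x = here , λ _ _ → z≤n

  dist-1 : ∀ {x z} → x ≢ z → Comparable x z → IsDist G x z 1
  dist-1 {x} {z} x≢z xz = step (x≢z , xz) here , bound
    where
    bound : ∀ k → Walk G x z k → 1 ≤ k
    bound zero here = contradiction refl x≢z
    bound (suc k) _ = s≤s z≤n

  walk-1 : ∀ {x z} → Walk G x z 1 → Comparable x z
  walk-1 (step (_ , xz) here) = xz

  dist-2 : ∀ {x z} → ¬ Comparable x z → IsDist G x z 2
  dist-2 {x} {z} ¬xz = step (x≢ε , inj₁ (ε≼ x)) (step (ε≢z , ε-comparable z) here) , bound
    where
    x≢ε : x ≢ ε
    x≢ε refl = ¬xz (ε-comparable z)
    ε≢z : ε ≢ z
    ε≢z refl = ¬xz (inj₁ (ε≼ x))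
    bound : ∀ k → Walk G x z k → 2 ≤ k
    bound zero here = contradiction (inj₁ ≼-refl) ¬xz
    bound (suc zero) w = contradiction (walk-1 w) ¬xz
    bound (suc (suc k)) _ = s≤s (s≤s z≤n)

  dist : ∀ x z → ∃[ m ] IsDist G x z m
  dist x z with x ≟ z | comparable? x z
  ... | yes refl | _ = 0 , dist-0 x
  ... | no x≢z | yes xz = 1 , dist-1 x≢z xz
  ... | no _ | no ¬xz = 2 , dist-2 ¬xz

  -- Comparability is reflexive and cannot tell distance 0 from distance 1; this is why `z ≡ x` and
  -- `z ≡ y` are listed apart.
  Separates : El G → El G → El G → Set
  Separates z x y = z ≡ x ⊎ z ≡ y ⊎ c x z ≢ c y z

  separates? : ∀ z x y → Dec (Separates z x y)
  separates? z x y = (z ≟ x) ⊎-dec (z ≟ y) ⊎-dec ¬? (c x z Bool.≟ c y z)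

  same-dist : ∀ {x y z} → x ≢ z → y ≢ z → c x z ≡ c y z → ∃[ m ] (IsDist G x z m × IsDist G y z m)
  same-dist {x} {y} {z} x≢z y≢z eq = by (comparable? x z)
    where
    by : Dec (Comparable x z) → ∃[ m ] (IsDist G x z m × IsDist G y z m)
    by (yes xz) = 1 , dist-1 x≢z xz , dist-1 y≢z (transfer eq xz)
    by (no ¬xz) = 2 , dist-2 ¬xz , dist-2 (λ yz → ¬xz (transfer (sym eq) yz))

  distinguishes⇒separates : ∀ {z x y} → Distinguishes G z x y → Separates z x y
  distinguishes⇒separates {z} {x} {y} d with z ≟ x | z ≟ y
  ... | yes z≡x | _ = inj₁ z≡x
  ... | no _ | yes z≡y = inj₂ (inj₁ z≡y)
  ... | no z≢x | no z≢y = inj₂ (inj₂ (λ eq → d (same-dist (≢-sym z≢x) (≢-sym z≢y) eq)))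

  adjacent-distinguishes : ∀ {z x y} → z ≢ x → z ≢ y → Comparable x z → ¬ Comparable y z → Distinguishes G z x y
  adjacent-distinguishes {z} {x} {y} z≢x z≢y xz ¬yz (m , (_ , min) , (wy , _)) =
    short m wy (min 1 (step ((λ e → z≢x (sym e)) , xz) here))
    where
    short : ∀ m → Walk G y z m → ¬ m ≤ 1
    short zero here _ = z≢y refl
    short (suc zero) w _ = ¬yz (walk-1 w)
    short (suc (suc m)) _ (s≤s ())

  distinguishes-self : ∀ {x y} → x ≢ y → Distinguishes G x x y
  distinguishes-self x≢y (m , (_ , min) , (wy , _)) with min 0 here
  distinguishes-self x≢y (zero , _ , (here , _)) | z≤n = x≢y refl

  distinguishes-sym : ∀ {z x y} → Distinguishes G z x y → Distinguishes G z y x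
  distinguishes-sym d (m , dy , dx) = d (m , dx , dy)

  separates⇒distinguishes : ∀ {z x y} → x ≢ y → Separates z x y → Distinguishes G z x y
  separates⇒distinguishes x≢y (inj₁ refl) = distinguishes-self x≢y
  separates⇒distinguishes x≢y (inj₂ (inj₁ refl)) = distinguishes-sym (distinguishes-self (≢-sym x≢y))
  separates⇒distinguishes {z} {x} {y} x≢y (inj₂ (inj₂ ne)) with z ≟ x | z ≟ y
  ... | yes refl | _ = distinguishes-self x≢y
  ... | no _ | yes refl = distinguishes-sym (distinguishes-self (≢-sym x≢y))
  ... | no z≢x | no z≢y with c-≢ ne
  ...   | inj₁ (xz , ¬yz) = adjacent-distinguishes z≢x z≢y xz ¬yz
  ...   | inj₂ (yz , ¬xz) = distinguishes-sym (adjacent-distinguishes z≢y z≢x yz ¬xz)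

  infix 4 _≈_
  -- Both clauses of `Twin` in one: open and closed neighbourhoods of `x` and `y` can differ only at
  -- `x` and `y`, and these two are left out.
  _≈_ : El G → El G → Set
  x ≈ y = ∀ z → z ≢ x → z ≢ y → c x z ≡ c y z

  differ : ∀ x y → x ≈ y ⊎ ∃[ z ] (z ≢ x × z ≢ y × c x z ≢ c y z)
  differ x y with any? (λ z → ¬? (z ≟ x) ×-dec ¬? (z ≟ y) ×-dec ¬? (c x z Bool.≟ c y z))
  ... | yes z = inj₂ z
  ... | no none = inj₁ agree
    where
    agree : x ≈ y
    agree z z≢x z≢y with c x z Bool.≟ c y z
    ... | yes eq = eq
    ... | no ne = contradiction (z , z≢x , z≢y , ne) none

  _≈?_ : ∀ x y → Dec (x ≈ y)
  x ≈? y with differ x y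
  ... | inj₁ x≈y = yes x≈y
  ... | inj₂ (z , z≢x , z≢y , ne) = no (λ x≈y → ne (x≈y z z≢x z≢y))

  ≈-refl : ∀ {x} → x ≈ x
  ≈-refl _ _ _ = refl

  ≈-sym : ∀ {x y} → x ≈ y → y ≈ x
  ≈-sym x≈y z z≢y z≢x = sym (x≈y z z≢x z≢y)

  -- At `v = y` neither hypothesis applies as it stands. By symmetry of `c`, the second is used at
  -- `x` and the first at `z`, which joins `c x y` to `c z y`.
  ≈-trans : ∀ {x y z} → x ≈ y → y ≈ z → x ≈ z
  ≈-trans {x} {y} {z} x≈y y≈z v v≢x v≢z with v ≟ y
  ... | no v≢y = trans (x≈y v v≢x v≢y) (y≈z v v≢y v≢z)
  ... | yes refl with x ≟ z
  ...   | yes refl = refl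
  ...   | no x≢z = begin
    c x y  ≡⟨ c-sym x y ⟩
    c y x  ≡⟨ y≈z x (≢-sym v≢x) x≢z ⟩
    c z x  ≡⟨ c-sym z x ⟩
    c x z  ≡⟨ x≈y z (≢-sym x≢z) (≢-sym v≢z) ⟩
    c y z  ≡⟨ c-sym y z ⟩
    c z y  ∎
    where open ≡-Reasoning

  twin⇒≈ : ∀ {x y} → Twin G x y → x ≈ y
  twin⇒≈ (inj₁ same) z z≢x z≢y = c-≡
    (λ xz → proj₂ (to (same z) (≢-sym z≢x , xz)))
    (λ yz → proj₂ (from (same z) (≢-sym z≢y , yz)))
  twin⇒≈ (inj₂ same) z z≢x z≢y = c-≡
    (λ xz → adjacent z≢y (to (same z) (inj₂ (≢-sym z≢x , xz))))
    (λ yz → adjacent z≢x (from (same z) (inj₂ (≢-sym z≢y , yz))))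
    where
    adjacent : ∀ {u} → z ≢ u → z ≡ u ⊎ Adj G u z → Comparable u z
    adjacent z≢u (inj₁ z≡u) = contradiction z≡u z≢u
    adjacent z≢u (inj₂ (_ , uz)) = uz

  -- Comparable twins share the closed neighbourhood, incomparable ones the open neighbourhood.
  ≈⇒twin : ∀ {x y} → x ≈ y → Twin G x y
  ≈⇒twin {x} {y} x≈y with comparable? x y
  ... | yes xy = inj₂ (λ z → mk⇔ (closed x≈y xy z) (closed (≈-sym x≈y) (comparable-sym xy) z))
    where
    closed : ∀ {x y} → x ≈ y → Comparable x y → ∀ z → z ≡ x ⊎ Adj G x z → z ≡ y ⊎ Adj G y z
    closed {x} {y} x≈y xy z h with z ≟ y
    ... | yes z≡y = inj₁ z≡y
    closed x≈y xy z (inj₁ refl) | no z≢y = inj₂ (≢-sym z≢y , comparable-sym xy)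
    closed x≈y xy z (inj₂ (x≢z , xz)) | no z≢y = inj₂ (≢-sym z≢y , transfer (x≈y z (≢-sym x≢z) z≢y) xz)
  ... | no ¬xy = inj₁ (λ z → mk⇔ (open′ x≈y ¬xy z) (open′ (≈-sym x≈y) (λ yx → ¬xy (comparable-sym yx)) z))
    where
    open′ : ∀ {x y} → x ≈ y → ¬ Comparable x y → ∀ z → Adj G x z → Adj G y z
    open′ {x} {y} x≈y ¬xy z (x≢z , xz) with z ≟ y
    ... | yes refl = contradiction xz ¬xy
    ... | no z≢y = ≢-sym z≢y , transfer (x≈y z (≢-sym x≢z) z≢y) xz

  Singleton : El G → Set
  Singleton w = ∀ {v} → w ≈ v → v ≡ w

  -- The condition `R{x,y} = {x,y,w}` with `w` different from `x` and `y`, in terms of `c`.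
  record OnlySeparatedBy (w x y : El G) : Set where
    constructor only
    field
      w≢x : w ≢ x
      w≢y : w ≢ y
      separated : c x w ≢ c y w
      agree : ∀ z → z ≢ x → z ≢ y → z ≢ w → c x z ≡ c y z

  open OnlySeparatedBy

  only-swap : ∀ {w x y} → OnlySeparatedBy w x y → OnlySeparatedBy w y x
  only-swap (only a b s h) = only b a (≢-sym s) (λ z p q r → sym (h z q p r))

  -- A witness pair matters only up to twins, so either end may be replaced by a twin missing from a
  -- given resolving set. That `w` is alone in its class guarantees `w ≢ x′`.
  only-≈ : ∀ {w x x′ y} → Singleton w → x ≈ x′ → OnlySeparatedBy w x y → OnlySeparatedBy w x′ y
  only-≈ {w} {x} {x′} {y} single x≈x′ o with x ≟ x′
  ... | yes refl = o
  ... | no x≢x′ = only w≢x′ (w≢y o) (λ eq → separated o (trans (x≈x′ w (w≢x o) w≢x′) eq)) agree′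
    where
    open ≡-Reasoning
    w≢x′ : w ≢ x′
    w≢x′ refl = w≢x o (sym (single (≈-sym x≈x′)))
    x′≢y : x′ ≢ y
    x′≢y refl = separated o (x≈x′ w (w≢x o) (w≢y o))
    x≢y : x ≢ y
    x≢y refl = separated o refl
    agree′ : ∀ z → z ≢ x′ → z ≢ y → z ≢ w → c x′ z ≡ c y z
    agree′ z z≢x′ z≢y z≢w with z ≟ x
    ... | no z≢x = trans (sym (x≈x′ z z≢x z≢x′)) (agree o z z≢x z≢y z≢w)
    -- The old end `x` was exempt before and must now be checked. Symmetry of `c` moves the question
    -- to `x′` for the pair `x`, `y`, and then to `y` for the twins `x`, `x′`.
    ... | yes refl = begin
      c x′ x  ≡⟨ c-sym x′ x ⟩
      c x x′  ≡⟨ agree o x′ (≢-sym x≢x′) x′≢y (≢-sym w≢x′) ⟩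
      c y x′  ≡⟨ c-sym y x′ ⟩
      c x′ y  ≡⟨ x≈x′ y (≢-sym x≢y) (≢-sym x′≢y) ⟨
      c x y   ≡⟨ c-sym x y ⟩
      c y x   ∎

  record Resolver (w : El G) : Set where
    constructor resolver
    field
      involution : IsInvolution G w
      singleton : Singleton w
      {x y} : El G
      only-separated : OnlySeparatedBy w x y

  -- The class of `w` is a singleton because a second member would separate `x` and `y` as well,
  -- while it differs from both, as neither is a twin of `w`.
  resolver⁺ : ∀ {w} → IsResolvingInvolution G w → Resolver w
  resolver⁺ {w} (iw , x , y , ¬xw , ¬yw , R) = resolver iw single o
    where
    ¬x≈w : ¬ x ≈ w
    ¬x≈w e = ¬xw (≈⇒twin e)
    ¬y≈w : ¬ y ≈ w
    ¬y≈w e = ¬yw (≈⇒twin e)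
    x≢y : x ≢ y
    x≢y refl with dist x x
    ... | m , d = from (R x) (inj₁ refl) (m , d , d)
    w≢x′ : w ≢ x
    w≢x′ refl = ¬x≈w ≈-refl
    w≢y′ : w ≢ y
    w≢y′ refl = ¬y≈w ≈-refl
    separated′ : c x w ≢ c y w
    separated′ with distinguishes⇒separates (from (R w) (inj₂ (inj₂ refl)))
    ... | inj₁ w≡x = contradiction w≡x w≢x′
    ... | inj₂ (inj₁ w≡y) = contradiction w≡y w≢y′
    ... | inj₂ (inj₂ ne) = ne
    agree′ : ∀ z → z ≢ x → z ≢ y → z ≢ w → c x z ≡ c y z
    agree′ z z≢x z≢y z≢w with c x z Bool.≟ c y z
    ... | yes eq = eq
    ... | no ne with to (R z) (separates⇒distinguishes x≢y (inj₂ (inj₂ ne)))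
    ...   | inj₁ z≡x = contradiction z≡x z≢x
    ...   | inj₂ (inj₁ z≡y) = contradiction z≡y z≢y
    ...   | inj₂ (inj₂ z≡w) = contradiction z≡w z≢w
    o : OnlySeparatedBy w x y
    o = only w≢x′ w≢y′ separated′ agree′
    single : Singleton w
    single {v} w≈v with v ≟ w
    ... | yes v≡w = v≡w
    ... | no v≢w = contradiction (begin
        c x w  ≡⟨ c-sym x w ⟩
        c w x  ≡⟨ w≈v x (≢-sym w≢x′) x≢v ⟩
        c v x  ≡⟨ c-sym v x ⟩
        c x v  ≡⟨ agree′ v (≢-sym x≢v) (≢-sym y≢v) v≢w ⟩
        c y v  ≡⟨ c-sym y v ⟩
        c v y  ≡⟨ w≈v y (≢-sym w≢y′) y≢v ⟨
        c w y  ≡⟨ c-sym w y ⟩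
        c y w  ∎) separated′
      where
      open ≡-Reasoning
      x≢v : x ≢ v
      x≢v refl = ¬x≈w (≈-sym w≈v)
      y≢v : y ≢ v
      y≢v refl = ¬y≈w (≈-sym w≈v)

  resolver⁻ : ∀ {w} → Resolver w → IsResolvingInvolution G w
  resolver⁻ {w} (resolver iw single {x} {y} o) =
    iw , x , y ,
    (λ xw → w≢x o (sym (single (≈-sym (twin⇒≈ xw))))) ,
    (λ yw → w≢y o (sym (single (≈-sym (twin⇒≈ yw))))) ,
    (λ z → mk⇔ (λ d → classify z (distinguishes⇒separates d)) (λ h → separates⇒distinguishes x≢y (separate z h)))
    where
    x≢y : x ≢ y
    x≢y refl = separated o refl
    classify : ∀ z → Separates z x y → z ≡ x ⊎ z ≡ y ⊎ z ≡ w
    classify z (inj₁ e) = inj₁ e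
    classify z (inj₂ (inj₁ e)) = inj₂ (inj₁ e)
    classify z (inj₂ (inj₂ ne)) with z ≟ x | z ≟ y | z ≟ w
    ... | yes e | _ | _ = inj₁ e
    ... | no _ | yes e | _ = inj₂ (inj₁ e)
    ... | no _ | no _ | yes e = inj₂ (inj₂ e)
    ... | no z≢x | no z≢y | no z≢w = contradiction (agree o z z≢x z≢y z≢w) ne
    separate : ∀ z → z ≡ x ⊎ z ≡ y ⊎ z ≡ w → Separates z x y
    separate z (inj₁ e) = inj₁ e
    separate z (inj₂ (inj₁ e)) = inj₂ (inj₁ e)
    separate z (inj₂ (inj₂ refl)) = inj₂ (inj₂ (separated o))

  -- Involutions in the power graph

  ≈⁻¹ : ∀ x → x ≈ x ⁻¹
  ≈⁻¹ x z _ _ = c-≡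
    (λ { (inj₁ z≼x) → inj₁ (≼-trans z≼x (≼⁻¹ x)) ; (inj₂ x≼z) → inj₂ (≼-trans (⁻¹≼ x) x≼z) })
    (λ { (inj₁ z≼x) → inj₁ (≼-trans z≼x (⁻¹≼ x)) ; (inj₂ x≼z) → inj₂ (≼-trans (≼⁻¹ x) x≼z) })

  singleton⇒involution : ∀ {x} → x ≢ ε → Singleton x → IsInvolution G x
  singleton⇒involution {x} x≢ε single with involution? x
  ... | yes ix = ix
  ... | no ¬ix = contradiction (single (≈⁻¹ x)) (≢⁻¹ x≢ε ¬ix)

  comparable-involution : ∀ {x w} → IsInvolution G w → x ≢ ε → x ≢ w → Comparable x w → w ≼ x
  comparable-involution iw x≢ε x≢w (inj₁ w≼x) = w≼x
  comparable-involution iw x≢ε x≢w (inj₂ x≼w) with ≼-involution iw x≼w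
  ... | inj₁ x≡ε = contradiction x≡ε x≢ε
  ... | inj₂ x≡w = contradiction x≡w x≢w

  comparable-involutions : ∀ {v w} → IsInvolution G v → IsInvolution G w → Comparable v w → v ≡ w
  comparable-involutions iv iw (inj₁ w≼v) = unique-involution iv iw ≼-refl w≼v
  comparable-involutions iv iw (inj₂ v≼w) = unique-involution iv iw v≼w ≼-refl

  above-≢ε : ∀ {w x} → IsInvolution G w → w ≼ x → x ≢ ε
  above-≢ε iw w≼x refl = involution-≢ε iw (≼ε w≼x)

  above-¬involution : ∀ {w x} → IsInvolution G w → w ≼ x → x ≢ w → ¬ IsInvolution G x
  above-¬involution iw w≼x x≢w ix = x≢w (unique-involution ix iw ≼-refl w≼x)

  -- The witness is a⁻¹, which is neither a nor an involution.
  agree⇒comparable : ∀ {a b} → a ≢ ε → ¬ IsInvolution G a →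
    (∀ z → z ≢ a → z ≢ b → ¬ IsInvolution G z → c a z ≡ c b z) → Comparable b a
  agree⇒comparable {a} {b} a≢ε ¬ia agree with a ⁻¹ ≟ b
  ... | yes refl = inj₁ (≼⁻¹ a)
  ... | no a⁻¹≢b with transfer (agree (a ⁻¹) (≢⁻¹ a≢ε ¬ia) a⁻¹≢b (⁻¹-¬involution a≢ε ¬ia)) (inj₁ (⁻¹≼ a))
  ...   | inj₁ a⁻¹≼b = inj₁ (≼-trans (≼⁻¹ a) a⁻¹≼b)
  ...   | inj₂ b≼a⁻¹ = inj₂ (≼-trans b≼a⁻¹ (⁻¹≼ a))

  -- The only separator is an involution, so `a` and `b` agree at all non-involutions other than
  -- themselves.
  only⇒comparable : ∀ {w a b} → IsInvolution G w → OnlySeparatedBy w a b → w ≼ a → Comparable b a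
  only⇒comparable iw o w≼a = agree⇒comparable (above-≢ε iw w≼a) (above-¬involution iw w≼a (≢-sym (w≢x o)))
    (λ z z≢a z≢b ¬iz → agree o z z≢a z≢b (λ { refl → ¬iz iw }))

  -- An involution is not an end of the pair of another one. If `v` is ε, a third involution also
  -- separates the pair. Otherwise `w′` lies below `v`, which is nested with `w`, so two involutions
  -- meet in one cyclic subgroup.
  ¬only-involution : ∀ {w w′ v} → IsInvolution G w → IsInvolution G w′ → w ≢ w′ → ¬ OnlySeparatedBy w′ w v
  ¬only-involution {w} {w′} {v} iw iw′ w≢w′ o with c-≢ (separated o)
  ... | inj₁ (ww′ , _) = w≢w′ (comparable-involutions iw iw′ ww′)
  ... | inj₂ (vw′ , _) with v ≟ ε
  ...   | yes refl with third-involution iw iw′ w≢w′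
  ...     | u , iu , u≢w , u≢w′ = u≢w (sym (comparable-involutions iw iu
              (transfer (sym (agree o u u≢w (involution-≢ε iu) u≢w′)) (ε-comparable u))))
  ¬only-involution {w} {w′} {v} iw iw′ w≢w′ o | inj₂ (vw′ , _) | no v≢ε with
    w′≼v ← comparable-involution iw′ v≢ε (≢-sym (w≢y o)) vw′
    with only⇒comparable iw′ (only-swap o) w′≼v
  ... | inj₁ v≼w = contradiction (unique-involution iw iw′ ≼-refl (≼-trans w′≼v v≼w)) w≢w′
  ... | inj₂ w≼v = contradiction (unique-involution iw iw′ w≼v w′≼v) w≢w′

  -- Each partner `vᵢ` is comparable to everything except `wᵢ`. So `w₁` lies below `v₂`, `w₂` below
  -- `v₁`, and the partners are nested; the larger one then lies above its own excluded involution.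
  only-injective-ε : ∀ {w₁ w₂ v₁ v₂} → IsInvolution G w₁ → IsInvolution G w₂ →
    OnlySeparatedBy w₁ ε v₁ → OnlySeparatedBy w₂ ε v₂ → w₁ ≡ w₂
  only-injective-ε {w₁} {w₂} {v₁} {v₂} i₁ i₂ o₁ o₂ with w₁ ≟ w₂
  ... | yes eq = eq
  ... | no w₁≢w₂ = contradiction (below o₁ i₁ i₂ w₁≢w₂) impossible
    where
    universal : ∀ {w v} → OnlySeparatedBy w ε v → ∀ {z} → z ≢ ε → z ≢ v → z ≢ w → Comparable v z
    universal o z≢ε z≢v z≢w = transfer (agree o _ z≢ε z≢v z≢w) (ε-comparable _)
    v≢ε : ∀ {w v} → OnlySeparatedBy w ε v → v ≢ ε
    v≢ε o refl = separated o refl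
    ¬vw : ∀ {w v} → OnlySeparatedBy w ε v → ¬ Comparable v w
    ¬vw o vw = separated o (trans (c⁺ (ε-comparable _)) (sym (c⁺ vw)))
    v≢w′ : ∀ {w v w′} → OnlySeparatedBy w ε v → IsInvolution G w → IsInvolution G w′ → w ≢ w′ → v ≢ w′
    v≢w′ o i i′ w≢w′ refl = ¬only-involution i′ i (≢-sym w≢w′) (only-swap o)
    below : ∀ {w v w′} → OnlySeparatedBy w ε v → IsInvolution G w → IsInvolution G w′ → w ≢ w′ → w′ ≼ v
    below o i i′ w≢w′ = comparable-involution i′ (v≢ε o) (v≢w′ o i i′ w≢w′)
      (universal o (involution-≢ε i′) (≢-sym (v≢w′ o i i′ w≢w′)) (≢-sym w≢w′))
    impossible : ¬ w₂ ≼ v₁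
    impossible w₂≼v₁ with v₁ ≟ v₂
    ... | yes refl = ¬vw o₂ (inj₁ w₂≼v₁)
    ... | no v₁≢v₂ with universal o₁ (v≢ε o₂) (≢-sym v₁≢v₂) (v≢w′ o₂ i₂ i₁ (≢-sym w₁≢w₂))
    ...   | inj₁ v₂≼v₁ = ¬vw o₁ (inj₁ (≼-trans (below o₂ i₂ i₁ (≢-sym w₁≢w₂)) v₂≼v₁))
    ...   | inj₂ v₁≼v₂ = ¬vw o₂ (inj₁ (≼-trans w₂≼v₁ v₁≼v₂))

  -- Here `w₁` is on the side of the shared vertex and `w₂` on that of its partner `v₂`. As `w₁`
  -- does not separate `u` from `v₂`, both involutions are comparable to `v₂`. If `v₂` is ε, a third
  -- involution must lie below `u` together with `w₁`.
  only-injective-mixed : ∀ {w₁ w₂ u v₁ v₂} → u ≢ ε → IsInvolution G w₁ → IsInvolution G w₂ →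
    OnlySeparatedBy w₁ u v₁ → OnlySeparatedBy w₂ u v₂ → w₁ ≢ w₂ →
    Comparable u w₁ → Comparable v₂ w₂ → w₁ ≡ w₂
  only-injective-mixed {w₁} {w₂} {u} {v₁} {v₂} u≢ε i₁ i₂ o₁ o₂ w₁≢w₂ uw₁ v₂w₂ with w₁ ≟ v₂ | v₂ ≟ ε
  ... | yes refl | _ = comparable-involutions i₁ i₂ v₂w₂
  ... | no w₁≢v₂ | no v₂≢ε = unique-involution i₁ i₂
    (comparable-involution i₁ v₂≢ε (≢-sym w₁≢v₂) (transfer (agree o₂ w₁ (w≢x o₁) w₁≢v₂ w₁≢w₂) uw₁))
    (comparable-involution i₂ v₂≢ε (≢-sym (w≢y o₂)) v₂w₂)
  ... | no _ | yes refl with third-involution i₁ i₂ w₁≢w₂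
  ...   | w₃ , i₃ , w₃≢w₁ , w₃≢w₂ = contradiction (unique-involution i₃ i₁ w₃≼u w₁≼u) w₃≢w₁
    where
    w₁≼u : w₁ ≼ u
    w₁≼u = comparable-involution i₁ u≢ε (≢-sym (w≢x o₁)) uw₁
    u≢w₃ : u ≢ w₃
    u≢w₃ refl = above-¬involution i₁ w₁≼u (≢-sym (w≢x o₁)) i₃
    w₃≼u : w₃ ≼ u
    w₃≼u = comparable-involution i₃ u≢ε u≢w₃
      (transfer (sym (agree o₂ w₃ (≢-sym u≢w₃) (involution-≢ε i₃) w₃≢w₂)) (ε-comparable w₃))

  -- This is the disjointness of witness pairs, reduced to a common end `u`. The cases record which
  -- end of its pair each involution is comparable to.
  only-injective : ∀ {w₁ w₂ u v₁ v₂} → IsInvolution G w₁ → IsInvolution G w₂ →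
    OnlySeparatedBy w₁ u v₁ → OnlySeparatedBy w₂ u v₂ → w₁ ≡ w₂
  only-injective {w₁} {w₂} {u} {v₁} {v₂} i₁ i₂ o₁ o₂ with u ≟ ε | w₁ ≟ w₂
  ... | yes refl | _ = only-injective-ε i₁ i₂ o₁ o₂
  ... | no _ | yes eq = eq
  ... | no u≢ε | no w₁≢w₂ with c-≢ (separated o₁) | c-≢ (separated o₂)
  ...   | inj₁ (uw₁ , _) | inj₁ (uw₂ , _) =
    unique-involution i₁ i₂ (comparable-involution i₁ u≢ε (≢-sym (w≢x o₁)) uw₁)
                            (comparable-involution i₂ u≢ε (≢-sym (w≢x o₂)) uw₂)
  ...   | inj₁ (uw₁ , _) | inj₂ (v₂w₂ , _) = only-injective-mixed u≢ε i₁ i₂ o₁ o₂ w₁≢w₂ uw₁ v₂w₂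
  only-injective {w₁} {w₂} {u} {v₁} {v₂} i₁ i₂ o₁ o₂ | no u≢ε | no w₁≢w₂ | inj₂ (v₁w₁ , _) | inj₁ (uw₂ , _) =
    sym (only-injective-mixed u≢ε i₂ i₁ o₂ o₁ (≢-sym w₁≢w₂) uw₂ v₁w₁)
  only-injective {w₁} {w₂} {u} {v₁} {v₂} i₁ i₂ o₁ o₂ | no u≢ε | no w₁≢w₂ | inj₂ (v₁w₁ , ¬uw₁) | inj₂ (v₂w₂ , ¬uw₂) = inside-both
    where
    -- Were the partner ε, it would be comparable to `w′`, and `u` would have to agree.
    outside-≢ε : ∀ {w w′ v} → IsInvolution G w′ → OnlySeparatedBy w u v → w′ ≢ w → w′ ≢ u → ¬ Comparable u w′ → v ≢ ε
    outside-≢ε iw′ o w′≢w w′≢u ¬uw′ refl = ¬uw′ (transfer (sym (agree o _ w′≢u (involution-≢ε iw′) w′≢w)) (ε-comparable _))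
    w₁≼v₁ : w₁ ≼ v₁
    w₁≼v₁ = comparable-involution i₁ (outside-≢ε i₂ o₁ (≢-sym w₁≢w₂) (w≢x o₂) ¬uw₂) (≢-sym (w≢y o₁)) v₁w₁
    w₂≼v₂ : w₂ ≼ v₂
    w₂≼v₂ = comparable-involution i₂ (outside-≢ε i₁ o₂ w₁≢w₂ (w≢x o₁) ¬uw₁) (≢-sym (w≢y o₂)) v₂w₂
    v₁≢u : v₁ ≢ u
    v₁≢u refl = separated o₁ refl
    v₁≢w₂ : v₁ ≢ w₂
    v₁≢w₂ refl = above-¬involution i₁ w₁≼v₁ (≢-sym (w≢y o₁)) i₂
    inside-both : w₁ ≡ w₂
    inside-both with v₁ ≟ v₂
    ... | yes refl = unique-involution i₁ i₂ w₁≼v₁ w₂≼v₂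
    -- Now `u` is comparable to `v₁`, which does not separate `u` from `v₂`. So `v₁` and `v₂` are
    -- nested, and the larger contains both involutions.
    ... | no v₁≢v₂ with transfer (agree o₂ v₁ v₁≢u v₁≢v₂ v₁≢w₂) (only⇒comparable i₁ (only-swap o₁) w₁≼v₁)
    ...   | inj₁ v₁≼v₂ = unique-involution i₁ i₂ (≼-trans w₁≼v₁ v₁≼v₂) w₂≼v₂
    ...   | inj₂ v₂≼v₁ = unique-involution i₁ i₂ w₁≼v₁ (≼-trans w₂≼v₂ v₂≼v₁)

-- For the lower bounds: `s` is the size of a resolving set, `u` the number of classes, and `e`
-- counts classes contained in the set.
∸-+-transpose : ∀ {n s u e} → s ≤ n → u ≤ n → (n ∸ s) + e ≤ u → n ∸ u + e ≤ s
∸-+-transpose {n} {s} {u} {e} s≤n u≤n h = +-cancelˡ-≤ u _ _ (begin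
  u + (n ∸ u + e)     ≡⟨ +-assoc u (n ∸ u) e ⟨
  u + (n ∸ u) + e     ≡⟨ cong (_+ e) (m+[n∸m]≡n u≤n) ⟩
  n + e               ≡⟨ cong (_+ e) (m∸n+n≡m s≤n) ⟨
  (n ∸ s) + s + e     ≡⟨ +-assoc (n ∸ s) s e ⟩
  (n ∸ s) + (s + e)   ≡⟨ cong ((n ∸ s) +_) (+-comm s e) ⟩
  (n ∸ s) + (e + s)   ≡⟨ +-assoc (n ∸ s) e s ⟨
  (n ∸ s) + e + s     ≤⟨ +-monoˡ-≤ s h ⟩
  u + s               ∎)
  where open ≤-Reasoning

-- Orders forced by comparability, and membership in Ψ

module Structure {n : ℕ} (G : FinGroup n) where
  open FinGroup G using (ε; isGroup) renaming (_∙_ to infixl 7 _∙_; _⁻¹ to infix 9 _⁻¹)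
  open IsGroup isGroup using (assoc; identityˡ; identityʳ; inverseˡ; inverseʳ)
  open PowerGraph G
  open GroupProperties group using (∙-cancelˡ; ∙-cancelʳ)
  open Twins G

  ≼-^-ε : ∀ {x y k} → y ≼ x → x ^ k ≡ ε → y ^ k ≡ ε
  ≼-^-ε {x} {k = k} (i , refl) x^k≡ε = trans (^-* x i k) (trans (cong (x ^_) (*-comm k i)) (^-*-ε i x^k≡ε))

  ≼⇒order∣ : ∀ {x y j k} → HasOrder G y j → HasOrder G x k → y ≼ x → j ∣ k
  ≼⇒order∣ {k = k} oy (_ , x^k≡ε , _) y≼x = order∣ oy (≼-^-ε {k = k} y≼x x^k≡ε)

  odd-prime-¬comparable : ∀ {x p s} → Prime p → p ≢ 2 → HasOrder G x p → IsInvolution G s → ¬ Comparable x s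
  odd-prime-¬comparable p-prime p≢2 ox is (inj₁ s≼x) = p≢2 (sym (prime∣prime prime[2] p-prime (≼⇒order∣ is ox s≼x)))
  odd-prime-¬comparable p-prime p≢2 ox is (inj₂ x≼s) = p≢2 (prime∣prime p-prime prime[2] (≼⇒order∣ ox is x≼s))

  odd-prime-¬involution : ∀ {x p} → p ≢ 2 → HasOrder G x p → ¬ IsInvolution G x
  odd-prime-¬involution p≢2 ox ix = p≢2 (order-unique ox ix)

  2p-¬involution : ∀ {h p} → Prime p → HasOrder G h (2 * p) → ¬ IsInvolution G h
  2p-¬involution {p = p} p-prime oh ih = ¬prime[1] (subst Prime (*-cancelˡ-≡ p 1 2 (order-unique oh ih)) p-prime)

  -- The order of `a` is divisible by 2 and `p`, hence by `2 * p`. The element `h` taken from ⟨a⟩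
  -- has an involution below it, and ⟨a⟩ has no involution but `w`.
  2p-element : ∀ {a b w p} → Prime p → p ≢ 2 → HasOrder G b p → IsInvolution G w → b ≼ a → w ≼ a →
               ∃[ h ] (HasOrder G h (2 * p) × h ≼ a × w ≼ h)
  2p-element {a} {p = p} p-prime p≢2 ob iw b≼a w≼a with order a
  ... | m , oa with ≼⇒order∣ ob oa b≼a
  ...   | divides e refl with euclidsLemma e p prime[2] (≼⇒order∣ iw oa w≼a)
  ...     | inj₂ 2∣p = contradiction (sym (prime∣prime prime[2] p-prime 2∣p)) p≢2
  ...     | inj₁ (divides f refl) with element-of-order oa (divides f (*-assoc f 2 p))
  ...       | h , h≼a , oh with element-of-order oh (m∣m*n {2} p)
  ...         | v , v≼h , iv =
    h , oh , h≼a , subst (_≼ h) (unique-involution iv iw (≼-trans v≼h h≼a) w≼a) v≼h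

  -- No involution lies below `b`, since `w` is the only one below `a`. For `y` of prime order `q`
  -- below `b`, some `h` of order `2 * q` lies between `w` and `a`. It cannot lie below `b`, so `b`
  -- lies below `h`, and `b ^ q`, whose square is ε, must itself be ε.
  order-is-odd-prime : ∀ {a b w} → IsInvolution G w → w ≼ a → b ≼ a → b ≢ ε → ¬ w ≼ b →
    (∀ h → h ≼ a → ¬ IsInvolution G h → h ≢ b → Comparable b h) →
    ∃[ p ] (Prime p × p ≢ 2 × HasOrder G b p)
  order-is-odd-prime {a} {b} {w} iw w≼a b≼a b≢ε w⋠b compare with prime-order-element b≢ε
  ... | q , y , q-prime , y≼b , oy = q , q-prime , q≢2 , prime-order q-prime b≢ε b^q≡ε
    where
    no-involution : ∀ {v} → v ≼ b → ¬ IsInvolution G v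
    no-involution v≼b iv = w⋠b (subst (_≼ b) (unique-involution iv iw (≼-trans v≼b b≼a) w≼a) v≼b)
    q≢2 : q ≢ 2
    q≢2 refl = no-involution y≼b oy
    b^2q≡ε : b ^ (2 * q) ≡ ε
    b^2q≡ε with 2p-element q-prime q≢2 oy iw (≼-trans y≼b b≼a) w≼a
    ... | h , oh , h≼a , w≼h with compare h h≼a (2p-¬involution q-prime oh) (λ { refl → w⋠b w≼h })
    ...   | inj₁ h≼b = contradiction (≼-trans w≼h h≼b) w⋠b
    ...   | inj₂ b≼h = ≼-^-ε {k = 2 * q} b≼h (proj₁ (proj₂ oh))
    b^q≡ε : b ^ q ≡ ε
    b^q≡ε with b ^ q ≟ ε
    ... | yes eq = eq
    ... | no ne = contradiction (prime-order prime[2] ne (trans (^-* b q 2) b^2q≡ε)) (no-involution (q , refl))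

  -- Conjugation and powers of commuting elements

  conj : El G → El G → El G
  conj g x = g ∙ x ∙ g ⁻¹

  conj-∙ : ∀ g x y → conj g x ∙ conj g y ≡ conj g (x ∙ y)
  conj-∙ g x y = begin
    (g ∙ x ∙ g ⁻¹) ∙ (g ∙ y ∙ g ⁻¹)   ≡⟨ assoc (g ∙ x) (g ⁻¹) _ ⟩
    g ∙ x ∙ (g ⁻¹ ∙ (g ∙ y ∙ g ⁻¹))   ≡⟨ cong (λ z → g ∙ x ∙ (g ⁻¹ ∙ z)) (assoc g y (g ⁻¹)) ⟩
    g ∙ x ∙ (g ⁻¹ ∙ (g ∙ (y ∙ g ⁻¹))) ≡⟨ cong (g ∙ x ∙_) (assoc (g ⁻¹) g _) ⟨
    g ∙ x ∙ (g ⁻¹ ∙ g ∙ (y ∙ g ⁻¹))   ≡⟨ cong (λ z → g ∙ x ∙ (z ∙ (y ∙ g ⁻¹))) (inverseˡ g) ⟩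
    g ∙ x ∙ (ε ∙ (y ∙ g ⁻¹))          ≡⟨ cong (g ∙ x ∙_) (identityˡ _) ⟩
    g ∙ x ∙ (y ∙ g ⁻¹)                ≡⟨ assoc (g ∙ x) y (g ⁻¹) ⟨
    g ∙ x ∙ y ∙ g ⁻¹                  ≡⟨ cong (_∙ g ⁻¹) (assoc g x y) ⟩
    g ∙ (x ∙ y) ∙ g ⁻¹                ∎
    where open ≡-Reasoning

  conj-ε : ∀ g → conj g ε ≡ ε
  conj-ε g = trans (cong (_∙ g ⁻¹) (identityʳ g)) (inverseʳ g)

  conj-^ : ∀ g x k → conj g x ^ k ≡ conj g (x ^ k)
  conj-^ g x zero = sym (conj-ε g)
  conj-^ g x (suc k) = trans (cong (conj g x ∙_) (conj-^ g x k)) (conj-∙ g x (x ^ k))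

  conj-injective : ∀ g {x y} → conj g x ≡ conj g y → x ≡ y
  conj-injective g eq = ∙-cancelˡ g _ _ (∙-cancelʳ (g ⁻¹) _ _ eq)

  conj-surjective : ∀ g y → ∃[ x ] y ≡ conj g x
  conj-surjective g y = g ⁻¹ ∙ y ∙ g , sym (begin
    g ∙ (g ⁻¹ ∙ y ∙ g) ∙ g ⁻¹    ≡⟨ cong (λ z → g ∙ z ∙ g ⁻¹) (assoc (g ⁻¹) y g) ⟩
    g ∙ (g ⁻¹ ∙ (y ∙ g)) ∙ g ⁻¹  ≡⟨ cong (_∙ g ⁻¹) (assoc g (g ⁻¹) (y ∙ g)) ⟨
    g ∙ g ⁻¹ ∙ (y ∙ g) ∙ g ⁻¹    ≡⟨ cong (λ z → z ∙ (y ∙ g) ∙ g ⁻¹) (inverseʳ g) ⟩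
    ε ∙ (y ∙ g) ∙ g ⁻¹           ≡⟨ cong (_∙ g ⁻¹) (identityˡ (y ∙ g)) ⟩
    y ∙ g ∙ g ⁻¹                 ≡⟨ assoc y g (g ⁻¹) ⟩
    y ∙ (g ∙ g ⁻¹)               ≡⟨ cong (y ∙_) (inverseʳ g) ⟩
    y ∙ ε                        ≡⟨ identityʳ y ⟩
    y                            ∎)
    where open ≡-Reasoning

  conj-involution : ∀ g {w} → IsInvolution G w → IsInvolution G (conj g w)
  conj-involution g {w} iw = mk-involution
    (λ eq → involution-≢ε iw (conj-injective g (trans eq (sym (conj-ε g)))))
    (trans (conj-∙ g w w) (trans (cong (conj g) (involution-square iw)) (conj-ε g)))

  commute-^ : ∀ {x y} → x ∙ y ≡ y ∙ x → ∀ k → y ∙ x ^ k ≡ x ^ k ∙ y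
  commute-^ {x} {y} xy≡yx zero = trans (identityʳ y) (sym (identityˡ y))
  commute-^ {x} {y} xy≡yx (suc k) = begin
    y ∙ (x ∙ x ^ k)   ≡⟨ assoc y x _ ⟨
    y ∙ x ∙ x ^ k     ≡⟨ cong (_∙ x ^ k) xy≡yx ⟨
    x ∙ y ∙ x ^ k     ≡⟨ assoc x y _ ⟩
    x ∙ (y ∙ x ^ k)   ≡⟨ cong (x ∙_) (commute-^ xy≡yx k) ⟩
    x ∙ (x ^ k ∙ y)   ≡⟨ assoc x _ y ⟨
    x ∙ x ^ k ∙ y     ∎
    where open ≡-Reasoning

  ∙-^ : ∀ {x y} → x ∙ y ≡ y ∙ x → ∀ k → (x ∙ y) ^ k ≡ x ^ k ∙ y ^ k
  ∙-^ xy≡yx zero = sym (identityˡ ε)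
  ∙-^ {x} {y} xy≡yx (suc k) = begin
    x ∙ y ∙ (x ∙ y) ^ k       ≡⟨ cong (x ∙ y ∙_) (∙-^ xy≡yx k) ⟩
    x ∙ y ∙ (x ^ k ∙ y ^ k)   ≡⟨ assoc x y _ ⟩
    x ∙ (y ∙ (x ^ k ∙ y ^ k)) ≡⟨ cong (x ∙_) (assoc y _ _) ⟨
    x ∙ (y ∙ x ^ k ∙ y ^ k)   ≡⟨ cong (λ z → x ∙ (z ∙ y ^ k)) (commute-^ xy≡yx k) ⟩
    x ∙ (x ^ k ∙ y ∙ y ^ k)   ≡⟨ cong (x ∙_) (assoc _ y _) ⟩
    x ∙ (x ^ k ∙ (y ∙ y ^ k)) ≡⟨ assoc x _ _ ⟨
    x ∙ x ^ k ∙ (y ∙ y ^ k)   ∎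
    where open ≡-Reasoning

  involution-^-odd : ∀ {v p} → IsInvolution G v → Prime p → p ≢ 2 → v ^ p ≡ v
  involution-^-odd {v} {p} iv p-prime p≢2 with ≼-involution iv (p , refl)
  ... | inj₂ eq = eq
  ... | inj₁ eq = contradiction (sym (prime∣prime prime[2] p-prime (order∣ iv eq))) p≢2

  -- The situation of an unresolved pair ε, `y`: as ε is comparable to everything, its other
  -- separators from `y` are the vertices incomparable to `y`. The order of `y` will be the odd
  -- prime of Ψ.
  module UniversalUpToInvolutions
    {y : El G} (y≢ε : y ≢ ε)
    (others : ∀ z → z ≢ ε → z ≢ y → ¬ Comparable y z → IsInvolution G z × Singleton z)
    where

    comparable-noninvolution : ∀ z → ¬ IsInvolution G z → Comparable y z
    comparable-noninvolution z ¬iz with comparable? y z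
    ... | yes yz = yz
    ... | no ¬yz = contradiction (proj₁ (others z (λ { refl → ¬yz (inj₁ (ε≼ y)) }) (λ { refl → ¬yz (inj₁ ≼-refl) }) ¬yz)) ¬iz

    odd-prime : ∀ {w g} → IsInvolution G w → ¬ Comparable y w → w ≼ g → g ≢ w → ∃[ p ] (Prime p × p ≢ 2 × HasOrder G y p)
    odd-prime {w} {g} iw ¬yw w≼g g≢w with comparable-noninvolution g (above-¬involution iw w≼g g≢w)
    ... | inj₁ g≼y = contradiction (inj₁ (≼-trans w≼g g≼y)) ¬yw
    ... | inj₂ y≼g = order-is-odd-prime iw w≼g y≼g y≢ε (λ w≼y → ¬yw (inj₁ w≼y)) (λ h _ ¬ih _ → comparable-noninvolution h ¬ih)

    module _ {p : ℕ} (p-prime : Prime p) (p≢2 : p ≢ 2) (oy : HasOrder G y p) where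

      ¬yv : ∀ {v} → IsInvolution G v → ¬ Comparable y v
      ¬yv = odd-prime-¬comparable p-prime p≢2 oy

      -- A non-involution is comparable to `y`, and one of two primes divides the other only if they
      -- are equal.
      prime-orders : ∀ {q h} → Prime q → HasOrder G h q → q ≡ 2 ⊎ (q ≡ p × y ≼ h)
      prime-orders {q} {h} q-prime oh with involution? h
      ... | yes ih = inj₁ (order-unique oh ih)
      ... | no ¬ih with comparable-noninvolution h ¬ih
      ...   | inj₂ y≼h = inj₂ (sym (prime∣prime p-prime q-prime (≼⇒order∣ oy oh y≼h)) , y≼h)
      ...   | inj₁ h≼y with prime∣prime q-prime p-prime (≼⇒order∣ oh oy h≼y)
      ...     | refl = inj₂ (refl , ≼-sym-of-order oy oh h≼y)

      -- Condition (C1) concerns the order of the group; Cauchy's theorem turns a prime divisor into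
      -- an element, to which comparability with `y` applies.
      prime-divisors : ∀ {q} → Prime q → q ∣ n → q ≡ 2 ⊎ q ≡ p
      prime-divisors q-prime q∣n with cauchy q-prime q∣n
      ... | h , oh with prime-orders q-prime oh
      ...   | inj₁ q≡2 = inj₁ q≡2
      ...   | inj₂ (q≡p , _) = inj₂ q≡p

      unique-subgroup : UniqueSubgroupOfOrder G p
      unique-subgroup = (⟨ y ⟩ , ⟨⟩-subgroup y , ∣⟨⟩∣ oy) ,
        λ H K sH ∣H∣ sK ∣K∣ → trans (is-⟨y⟩ sH ∣H∣) (sym (is-⟨y⟩ sK ∣K∣))
        where
        is-⟨y⟩ : ∀ {H} → IsSubgroup G H → ∣ H ∣ ≡ p → H ≡ ⟨ y ⟩
        is-⟨y⟩ {H} sub ∣H∣≡p with element-of-prime-subgroup p-prime sub ∣H∣≡p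
        ... | h , h∈H , oh with prime-orders p-prime oh
        ...   | inj₁ p≡2 = contradiction p≡2 p≢2
        ...   | inj₂ (_ , y≼h) = ⊆-antisym (⊆∧∣∣≥⇒⊇ ⟨y⟩⊆H (≤-reflexive (trans ∣H∣≡p (sym (∣⟨⟩∣ oy))))) ⟨y⟩⊆H
          where
          ⟨y⟩⊆H : ⟨ y ⟩ ⊆ H
          ⟨y⟩⊆H z∈ = subgroup-≼ sub h∈H (≼-trans (∈-fromDec⁻ (_≼? y) z∈) y≼h)

      no-order-4 : ∀ g → ¬ HasOrder G g 4
      no-order-4 g og with comparable-noninvolution g (λ ig → contradiction (order-unique og ig) λ ())
      ... | inj₁ g≼y = p≢2 (sym (prime∣prime prime[2] p-prime (∣-trans (divides 2 refl) (≼⇒order∣ og oy g≼y))))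
      ... | inj₂ y≼g with euclidsLemma 2 2 p-prime (≼⇒order∣ oy og y≼g)
      ...   | inj₁ p∣2 = p≢2 (prime∣prime p-prime prime[2] p∣2)
      ...   | inj₂ p∣2 = p≢2 (prime∣prime p-prime prime[2] p∣2)

      -- The conjugates of an involution v lying in no larger cyclic subgroup are twins of v, hence
      -- equal to v; so v commutes with y, and then v ∈ ⟨v y⟩.
      ¬isolated : ∀ {v} → IsInvolution G v → ¬ (∀ g → v ≼ g → g ≡ v)
      ¬isolated {v} iv isolated = contradiction (isolated (v ∙ y) (p , sym vy^p≡v)) vy≢v
        where
        v′ = conj y v
        iv′ = conj-involution y iv
        isolated′ : ∀ z → v′ ≼ z → z ≡ v′
        isolated′ z (k , v′≡z^k) with conj-surjective y z
        ... | z₀ , refl = cong (conj y) (isolated z₀ (k , conj-injective y (trans v′≡z^k (conj-^ y z₀ k))))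
        only-ε : ∀ {u z} → IsInvolution G u → (∀ z → u ≼ z → z ≡ u) → z ≢ u → Comparable u z → z ≡ ε
        only-ε iu iso z≢u (inj₂ u≼z) = contradiction (iso _ u≼z) z≢u
        only-ε iu iso z≢u (inj₁ z≼u) with ≼-involution iu z≼u
        ... | inj₁ z≡ε = z≡ε
        ... | inj₂ z≡u = contradiction z≡u z≢u
        v≈v′ : v ≈ v′
        v≈v′ z z≢v z≢v′ = c-≡
          (λ vz → subst (Comparable v′) (sym (only-ε iv isolated z≢v vz)) (inj₁ (ε≼ v′)))
          (λ v′z → subst (Comparable v) (sym (only-ε iv′ isolated′ z≢v′ v′z)) (inj₁ (ε≼ v)))
        v′≡v : v′ ≡ v
        v′≡v = proj₂ (others v (involution-≢ε iv) (λ { refl → ¬yv iv (inj₁ ≼-refl) }) (¬yv iv)) v≈v′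
        commute : v ∙ y ≡ y ∙ v
        commute = begin
          v ∙ y                  ≡⟨ cong (_∙ y) v′≡v ⟨
          y ∙ v ∙ y ⁻¹ ∙ y       ≡⟨ assoc (y ∙ v) (y ⁻¹) y ⟩
          y ∙ v ∙ (y ⁻¹ ∙ y)     ≡⟨ cong (y ∙ v ∙_) (inverseˡ y) ⟩
          y ∙ v ∙ ε              ≡⟨ identityʳ (y ∙ v) ⟩
          y ∙ v                  ∎
          where open ≡-Reasoning
        vy^p≡v : (v ∙ y) ^ p ≡ v
        vy^p≡v = trans (∙-^ commute p) (trans (cong₂ _∙_ (involution-^-odd iv p-prime p≢2) (proj₁ (proj₂ oy))) (identityʳ v))
        vy≢v : v ∙ y ≢ v
        vy≢v eq = y≢ε (∙-cancelˡ v y ε (trans eq (sym (identityʳ v))))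

      -- By `¬isolated` some `g` lies strictly above `v`. Being no involution it is nested with `y`,
      -- and it lies above `y` because `v` is incomparable to `y`.
      involutions-in-2p : ∀ v → IsInvolution G v → ∃[ h ] (HasOrder G h (2 * p) × v ≼ h)
      involutions-in-2p v iv with any? (λ g → (v ≼? g) ×-dec ¬? (g ≟ v))
      ... | no none = contradiction isolated (¬isolated iv)
        where
        isolated : ∀ g → v ≼ g → g ≡ v
        isolated g v≼g with g ≟ v
        ... | yes eq = eq
        ... | no g≢v = contradiction (g , v≼g , g≢v) none
      ... | yes (g , v≼g , g≢v) with comparable-noninvolution g (above-¬involution iv v≼g g≢v)
      ...   | inj₁ g≼y = contradiction (inj₁ (≼-trans v≼g g≼y)) (¬yv iv)
      ...   | inj₂ y≼g with 2p-element p-prime p≢2 oy iv y≼g v≼g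
      ...     | h , oh , _ , v≼h = h , oh , v≼h

    inΨ : ∀ {w₁ w₂} → IsInvolution G w₁ → IsInvolution G w₂ → w₁ ≢ w₂ →
          Singleton w₁ → ¬ Comparable y w₁ → ¬ Comparable y w₂ → InΨ G
    inΨ {w₁} {w₂} i₁ i₂ w₁≢w₂ single₁ ¬yw₁ ¬yw₂ = noncyclic , conclude above
      where
      noncyclic : ¬ Cyclic G
      noncyclic (g , generates) = w₁≢w₂ (unique-involution i₁ i₂ (generates w₁) (generates w₂))
      above : ∃[ p ] (Prime p × p ≢ 2 × HasOrder G y p)
      -- `odd-prime` needs an element strictly above an involution. As `w₁` and `w₂` are not twins,
      -- some `z ≢ ε` is comparable to exactly one of them and therefore lies above that one.
      above with differ w₁ w₂
      ... | inj₁ w₁≈w₂ = contradiction (sym (single₁ w₁≈w₂)) w₁≢w₂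
      ... | inj₂ (z , z≢w₁ , z≢w₂ , ne) with z ≟ ε | c-≢ ne
      ...   | yes refl | _ = contradiction (trans (c⁺ (inj₁ (ε≼ w₁))) (sym (c⁺ (inj₁ (ε≼ w₂))))) ne
      ...   | no z≢ε | inj₁ (w₁z , _) = odd-prime i₁ ¬yw₁ (comparable-involution i₁ z≢ε z≢w₁ (comparable-sym w₁z)) z≢w₁
      ...   | no z≢ε | inj₂ (w₂z , _) = odd-prime i₂ ¬yw₂ (comparable-involution i₂ z≢ε z≢w₂ (comparable-sym w₂z)) z≢w₂
      conclude : ∃[ p ] (Prime p × p ≢ 2 × HasOrder G y p) → _
      conclude (p , p-prime , p≢2 , oy) = p , p-prime , p≢2 ,
        (λ q q-prime → mk⇔ (prime-divisors p-prime p≢2 oy q-prime)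
          (λ { (inj₁ refl) → prime-order∣n prime[2] i₁ ; (inj₂ refl) → prime-order∣n p-prime oy })) ,
        unique-subgroup p-prime p≢2 oy ,
        no-order-4 p-prime p≢2 oy , involutions-in-2p p-prime p≢2 oy

-- Bounds on the metric dimension

module Dimension {n : ℕ} (G : FinGroup n) where
  open FinGroup G using (ε)
  open PowerGraph G
  open Twins G
  open Structure G
  open OnlySeparatedBy

  record Transversal (T : Subset n) : Set where
    constructor transversal
    field
      representative : ∀ x → ∃[ t ] (t ∈ₛ T × x ≈ t)
      distinct : ∀ {s t} → s ∈ₛ T → t ∈ₛ T → s ≈ t → s ≡ t

  resolving-separates : ∀ {S} → Resolving G S → ∀ {x y} → x ≢ y → x ∉ₛ S → y ∉ₛ S →
    ∃[ s ] (s ∈ₛ S × s ≢ x × s ≢ y × c x s ≢ c y s)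
  resolving-separates res {x} {y} x≢y x∉S y∉S with res x y x≢y
  ... | s , s∈S , d with distinguishes⇒separates d
  ...   | inj₁ refl = contradiction s∈S x∉S
  ...   | inj₂ (inj₁ refl) = contradiction s∈S y∉S
  ...   | inj₂ (inj₂ ne) = s , s∈S , (λ { refl → x∉S s∈S }) , (λ { refl → y∉S s∈S }) , ne

  missing⊎full : ∀ S x → (∃[ v ] (x ≈ v × v ∉ₛ S)) ⊎ (∀ v → x ≈ v → v ∈ₛ S)
  missing⊎full S x with any? (λ v → (x ≈? v) ×-dec ¬? (v ∈? S))
  ... | yes found = inj₁ found
  ... | no none = inj₂ full
    where
    full : ∀ v → x ≈ v → v ∈ₛ S
    full v x≈v with v ∈? S
    ... | yes v∈S = v∈S
    ... | no v∉S = contradiction (v , x≈v , v∉S) none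

  module _ {T : Subset n} (tr : Transversal T) where
    open Transversal tr

    -- A resolving set misses at most one vertex of each twin class, so |∁ S| counts
    -- classes meeting ∁ S, while F picks out distinct classes contained in S.
    size-lower-bound : ∀ {S} → Resolving G S → ∀ (ws : List (El G)) → Unique ws →
      (F : El G → El G → Set) →
      (∀ {w} → w ∈ ws → ∃[ x ] ((∀ v → x ≈ v → v ∈ₛ S) × F w x)) →
      (∀ {w w′ x x′} → w ∈ ws → w′ ∈ ws → F w x → F w′ x′ → x ≈ x′ → w ≡ w′) →
      n ∸ ∣ T ∣ + length ws ≤ ∣ S ∣
    size-lower-bound {S} res ws ws! F image F-inj = ∸-+-transpose (∣p∣≤n S) (∣p∣≤n T) (begin
      n ∸ ∣ S ∣ + length ws                          ≡⟨ cong (_+ length ws) (∣∁p∣≡n∸∣p∣ S) ⟨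
      ∣ ∁ S ∣ + length ws                            ≡⟨ cong₂ _+_ lengthˡ (length-map inj₂ ws) ⟨
      length missed + length (map inj₂ ws)           ≡⟨ length-++ missed ⟨
      length (missed ++ map inj₂ ws)                 ≤⟨ length-≤-by-relation Class unique covered injective ⟩
      length (elements T)                            ≡⟨ length-elements T ⟩
      ∣ T ∣                                          ∎)
      where
      open ≤-Reasoning
      missed : List (El G ⊎ El G)
      missed = map inj₁ (elements (∁ S))
      lengthˡ : length missed ≡ ∣ ∁ S ∣
      lengthˡ = trans (length-map inj₁ (elements (∁ S))) (length-elements (∁ S))
      Class : El G ⊎ El G → El G → Set
      Class (inj₁ g) t = g ≈ t
      Class (inj₂ w) t = ∃[ x ] (x ≈ t × (∀ v → x ≈ v → v ∈ₛ S) × F w x)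
      unique : Unique (missed ++ map inj₂ ws)
      unique = Uniq.++⁺ (Uniq.map⁺ (λ { refl → refl }) (elements-unique (∁ S))) (Uniq.map⁺ (λ { refl → refl }) ws!) disjoint
        where
        disjoint : ∀ {z} → ¬ (z ∈ missed × z ∈ map inj₂ ws)
        disjoint (z∈₁ , z∈₂) with ∈-map⁻ inj₁ z∈₁ | ∈-map⁻ inj₂ z∈₂
        ... | _ , _ , refl | _ , _ , ()
      ∈-missed : ∀ {g} → inj₁ g ∈ missed ++ map inj₂ ws → g ∉ₛ S
      ∈-missed g∈ with ∈-++⁻ missed g∈
      ... | inj₁ g∈₁ with ∈-map⁻ inj₁ g∈₁
      ...   | _ , g∈∁S , refl = x∈∁p⇒x∉p (∈-elements⁻ (∁ S) g∈∁S)
      ∈-missed g∈ | inj₂ g∈₂ with ∈-map⁻ inj₂ g∈₂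
      ... | _ , _ , ()
      ∈-ws : ∀ {w} → inj₂ w ∈ missed ++ map inj₂ ws → w ∈ ws
      ∈-ws w∈ with ∈-++⁻ missed w∈
      ... | inj₂ w∈₂ with ∈-map⁻ inj₂ w∈₂
      ...   | _ , w∈ws , refl = w∈ws
      ∈-ws w∈ | inj₁ w∈₁ with ∈-map⁻ inj₁ w∈₁
      ... | _ , _ , ()
      covered : ∀ {z} → z ∈ missed ++ map inj₂ ws → ∃[ t ] (t ∈ elements T × Class z t)
      covered {inj₁ g} z∈ with representative g
      ... | t , t∈T , g≈t = t , ∈-elements⁺ t∈T , g≈t
      covered {inj₂ w} z∈ with image (∈-ws z∈)
      ... | x , full , Fwx with representative x
      ...   | t , t∈T , x≈t = t , ∈-elements⁺ t∈T , x , x≈t , full , Fwx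
      injective : ∀ {z z′ t} → z ∈ missed ++ map inj₂ ws → z′ ∈ missed ++ map inj₂ ws → Class z t → Class z′ t → z ≡ z′
      injective {inj₁ g} {inj₁ g′} z∈ z′∈ g≈t g′≈t with g ≟ g′
      ... | yes refl = refl
      ... | no g≢g′ with resolving-separates res g≢g′ (∈-missed z∈) (∈-missed z′∈)
      ...   | s , _ , s≢g , s≢g′ , ne = contradiction (≈-trans g≈t (≈-sym g′≈t) s s≢g s≢g′) ne
      injective {inj₁ g} {inj₂ w} z∈ z′∈ g≈t (x , x≈t , full , _) =
        contradiction (full g (≈-trans x≈t (≈-sym g≈t))) (∈-missed z∈)
      injective {inj₂ w} {inj₁ g} z∈ z′∈ (x , x≈t , full , _) g≈t =
        contradiction (full g (≈-trans x≈t (≈-sym g≈t))) (∈-missed z′∈)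
      injective {inj₂ w} {inj₂ w′} z∈ z′∈ (x , x≈t , _ , Fwx) (x′ , x′≈t , _ , Fw′x′) =
        cong inj₂ (F-inj (∈-ws z∈) (∈-ws z′∈) Fwx Fw′x′ (≈-trans x≈t (≈-sym x′≈t)))

    Unresolved : Subset n → El G → El G → Set
    Unresolved E x y = ∀ z → z ≢ x → z ≢ y → c x z ≢ c y z → IsInvolution G z × Singleton z × z ∉ₛ E

    -- The set is `∁ T ∪ E`. Both upper bounds come from it, with `E` the resolving involutions
    -- outside Ψ and a single vertex inside Ψ.
    resolving-by-adding : ∀ E → E ⊆ T →
      (∀ {x y} → x ∈ₛ T → y ∈ₛ T → x ∉ₛ E → y ∉ₛ E → ¬ x ≈ y → ¬ Unresolved E x y) →
      ∃[ S ] (Resolving G S × ∣ S ∣ ≡ n ∸ ∣ T ∣ + ∣ E ∣)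
    resolving-by-adding E E⊆T resolved = S , resolving , size
      where
      S = ∁ T ∪ E
      size : ∣ S ∣ ≡ n ∸ ∣ T ∣ + ∣ E ∣
      size = trans (∣p∪q∣≡∣p∣+∣q∣ (∁ T) E (λ x∈∁T x∈E → x∈∁p⇒x∉p x∈∁T (E⊆T x∈E))) (cong (_+ ∣ E ∣) (∣∁p∣≡n∸∣p∣ T))
      ∉S⇒∈T : ∀ {x} → x ∉ₛ S → x ∈ₛ T
      ∉S⇒∈T x∉S = x∉∁p⇒x∈p (λ x∈∁T → x∉S (x∈p∪q⁺ (inj₁ x∈∁T)))
      ∉S⇒∉E : ∀ {x} → x ∉ₛ S → x ∉ₛ E
      ∉S⇒∉E x∉S x∈E = x∉S (x∈p∪q⁺ (inj₂ x∈E))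
      resolving : Resolving G S
      resolving x y x≢y with any? (λ s → (s ∈? S) ×-dec separates? s x y)
      ... | yes (s , s∈S , sep) = s , s∈S , separates⇒distinguishes x≢y sep
      ... | no none = contradiction unresolved
              (resolved (∉S⇒∈T x∉S) (∉S⇒∈T y∉S) (∉S⇒∉E x∉S) (∉S⇒∉E y∉S)
                (λ x≈y → x≢y (distinct (∉S⇒∈T x∉S) (∉S⇒∈T y∉S) x≈y)))
        where
        x∉S : x ∉ₛ S
        x∉S x∈S = none (x , x∈S , inj₁ refl)
        y∉S : y ∉ₛ S
        y∉S y∈S = none (y , y∈S , inj₂ (inj₁ refl))
        unresolved : Unresolved E x y
        unresolved z z≢x z≢y ne = singleton⇒involution z≢ε single , single , ∉S⇒∉E z∉S
          where
          z∉S : z ∉ₛ S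
          z∉S z∈S = none (z , z∈S , inj₂ (inj₂ ne))
          z≢ε : z ≢ ε
          z≢ε refl = ne (trans (c⁺ (inj₁ (ε≼ x))) (sym (c⁺ (inj₁ (ε≼ y)))))
          -- A twin of `z` separates `x` and `y` too, so it is also missing from `S`. Then it lies
          -- in `T` together with `z`, and `T` meets each class once.
          single : Singleton z
          single {v} z≈v with v ∈? S
          ... | no v∉S = sym (distinct (∉S⇒∈T z∉S) (∉S⇒∈T v∉S) z≈v)
          ... | yes v∈S = contradiction (v , v∈S , inj₂ (inj₂ v-separates)) none
            where
            x≢v : x ≢ v
            x≢v refl = x∉S v∈S
            y≢v : y ≢ v
            y≢v refl = y∉S v∈S
            open ≡-Reasoning
            v-separates : c x v ≢ c y v
            v-separates eq = ne (begin
              c x z  ≡⟨ c-sym x z ⟩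
              c z x  ≡⟨ z≈v x (≢-sym z≢x) x≢v ⟩
              c v x  ≡⟨ c-sym v x ⟩
              c x v  ≡⟨ eq ⟩
              c y v  ≡⟨ c-sym y v ⟩
              c v y  ≡⟨ z≈v y (≢-sym z≢y) y≢v ⟨
              c z y  ≡⟨ c-sym z y ⟩
              c y z  ∎)

    -- Groups outside Ψ

    module _ {W : Subset n} (W-resolvers : ∀ w → w ∈ₛ W ⇔ IsResolvingInvolution G w) where

      W⇒resolver : ∀ {w} → w ∈ₛ W → Resolver w
      W⇒resolver w∈W = resolver⁺ (to (W-resolvers _) w∈W)

      W⊆T : W ⊆ T
      W⊆T {w} w∈W with representative w
      ... | t , t∈T , w≈t = subst (_∈ₛ T) (Resolver.singleton (W⇒resolver w∈W) w≈t) t∈T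

      -- Each resolving involution is assigned a class contained in `S`: its own if it lies in `S`,
      -- otherwise that of one end of its pair. If both ends had twins outside `S`, these would
      -- again be separated by `w` alone and `S` would not resolve them.
      size-≥-resolvers : ∀ {S} → Resolving G S → n ∸ ∣ T ∣ + ∣ W ∣ ≤ ∣ S ∣
      size-≥-resolvers {S} res = subst (λ k → n ∸ ∣ T ∣ + k ≤ ∣ S ∣) (length-elements W)
        (size-lower-bound res (elements W) (elements-unique W) Assigned
          (λ w∈ → assign (W⇒resolver (∈-elements⁻ W w∈)))
          (λ w∈ w′∈ → injective (W⇒resolver (∈-elements⁻ W w∈)) (W⇒resolver (∈-elements⁻ W w′∈))))
        where
        Assigned : El G → El G → Set
        Assigned w x = x ≡ w ⊎ ∃[ y ] OnlySeparatedBy w x y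

        assign : ∀ {w} → Resolver w → ∃[ x ] ((∀ v → x ≈ v → v ∈ₛ S) × Assigned w x)
        assign {w} (resolver _ single {x} {y} o) with w ∈? S
        ... | yes w∈S = w , (λ v w≈v → subst (_∈ₛ S) (sym (single w≈v)) w∈S) , inj₁ refl
        ... | no w∉S with missing⊎full S x | missing⊎full S y
        ...   | inj₂ full | _ = x , full , inj₂ (y , o)
        ...   | inj₁ _ | inj₂ full = y , full , inj₂ (x , only-swap o)
        ...   | inj₁ (x′ , x≈x′ , x′∉S) | inj₁ (y′ , y≈y′ , y′∉S) =
          contradiction (resolving-separates res (λ { refl → separated o′ refl }) x′∉S y′∉S) unseparated
          where
          o′ : OnlySeparatedBy w x′ y′
          o′ = only-swap (only-≈ single y≈y′ (only-swap (only-≈ single x≈x′ o)))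
          unseparated : ¬ (∃[ s ] (s ∈ₛ S × s ≢ x′ × s ≢ y′ × c x′ s ≢ c y′ s))
          unseparated (s , s∈S , s≢x′ , s≢y′ , ne) = ne (agree o′ s s≢x′ s≢y′ (λ { refl → w∉S s∈S }))

        injective : ∀ {w w′ x x′} → Resolver w → Resolver w′ → Assigned w x → Assigned w′ x′ → x ≈ x′ → w ≡ w′
        injective r r′ (inj₁ refl) (inj₁ refl) w≈w′ = sym (Resolver.singleton r w≈w′)
        injective {w} {w′} r r′ (inj₁ refl) (inj₂ (y , o)) w≈x′ with w ≟ w′ | Resolver.singleton r w≈x′
        ... | yes eq | _ = eq
        ... | no w≢w′ | refl = contradiction o (¬only-involution (Resolver.involution r) (Resolver.involution r′) w≢w′)
        injective {w} {w′} r r′ (inj₂ (y , o)) (inj₁ refl) x≈w′ with w ≟ w′ | Resolver.singleton r′ (≈-sym x≈w′)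
        ... | yes eq | _ = eq
        ... | no w≢w′ | refl = contradiction o (¬only-involution (Resolver.involution r′) (Resolver.involution r) (≢-sym w≢w′))
        injective r r′ (inj₂ (y , o)) (inj₂ (y′ , o′)) x≈x′ =
          only-injective (Resolver.involution r) (Resolver.involution r′) o (only-≈ (Resolver.singleton r′) (≈-sym x≈x′) o′)

      resolving-by-resolvers : ¬ InΨ G → ∃[ S ] (Resolving G S × ∣ S ∣ ≡ n ∸ ∣ T ∣ + ∣ W ∣)
      resolving-by-resolvers ¬Ψ = resolving-by-adding W W⊆T resolved
        where
        -- Two separators of ε and `y` give two involutions incomparable to `y`, the input of `inΨ`.
        universal : ∀ {y w w′} → y ≢ ε → Unresolved W ε y → w ≢ ε → w ≢ y → w′ ≢ ε → w′ ≢ y →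
                    c ε w ≢ c y w → c ε w′ ≢ c y w′ → w ≢ w′ → InΨ G
        universal {y} {w} {w′} y≢ε un w≢ε w≢y w′≢ε w′≢y ne ne′ w≢w′ =
          UniversalUpToInvolutions.inΨ y≢ε others
            (proj₁ (un w w≢ε w≢y ne)) (proj₁ (un w′ w′≢ε w′≢y ne′)) w≢w′ (proj₁ (proj₂ (un w w≢ε w≢y ne)))
            (incomparable ne) (incomparable ne′)
          where
          incomparable : ∀ {z} → c ε z ≢ c y z → ¬ Comparable y z
          incomparable {z} ne yz = ne (trans (c⁺ (ε-comparable z)) (sym (c⁺ yz)))
          others : ∀ z → z ≢ ε → z ≢ y → ¬ Comparable y z → IsInvolution G z × Singleton z
          others z z≢ε z≢y ¬yz with un z z≢ε z≢y (λ eq → ¬yz (transfer eq (ε-comparable z)))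
          ... | iz , single , _ = iz , single

        unresolved-swap : ∀ {x y} → Unresolved W x y → Unresolved W y x
        unresolved-swap un z z≢y z≢x ne = un z z≢x z≢y (≢-sym ne)

        -- Without ε, two separators are impossible. On the same side they would share a cyclic
        -- subgroup. On opposite sides, `x` and `y` are nested because they agree at
        -- non-involutions, and the larger lies above the involution it should miss.
        two-sided : ∀ {x y w w′} → Unresolved W x y → x ≢ ε → y ≢ ε → w ≢ x → w′ ≢ x → w′ ≢ y →
          IsInvolution G w → IsInvolution G w′ → w ≢ w′ →
          Comparable x w → ¬ Comparable y w → ¬ (c x w′ ≢ c y w′)
        two-sided {x} {y} {w} {w′} un x≢ε y≢ε w≢x w′≢x w′≢y iw iw′ w≢w′ xw ¬yw ne′
          with w≼x ← comparable-involution iw x≢ε (≢-sym w≢x) xw | c-≢ ne′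
        ... | inj₁ (xw′ , _) = w≢w′ (unique-involution iw iw′ w≼x (comparable-involution iw′ x≢ε (≢-sym w′≢x) xw′))
        ... | inj₂ (yw′ , ¬xw′) with agree⇒comparable x≢ε (above-¬involution iw w≼x (≢-sym w≢x)) agreement
          where
          agreement : ∀ z → z ≢ x → z ≢ y → ¬ IsInvolution G z → c x z ≡ c y z
          agreement z z≢x z≢y ¬iz with c x z Bool.≟ c y z
          ... | yes eq = eq
          ... | no ne = contradiction (proj₁ (un z z≢x z≢y ne)) ¬iz
        ...   | inj₁ x≼y = ¬yw (inj₁ (≼-trans w≼x x≼y))
        ...   | inj₂ y≼x = ¬xw′ (inj₁ (≼-trans (comparable-involution iw′ y≢ε (≢-sym w′≢y) yw′) y≼x))

        resolved : ∀ {x y} → x ∈ₛ T → y ∈ₛ T → x ∉ₛ W → y ∉ₛ W → ¬ x ≈ y → ¬ Unresolved W x y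
        resolved {x} {y} _ _ _ _ ¬x≈y un with differ x y
        ... | inj₁ x≈y = ¬x≈y x≈y
        ... | inj₂ (w , w≢x , w≢y , ne) with un w w≢x w≢y ne
        ...   | iw , single , w∉W with any? (λ w′ → ¬? (w′ ≟ x) ×-dec ¬? (w′ ≟ y) ×-dec ¬? (w′ ≟ w) ×-dec ¬? (c x w′ Bool.≟ c y w′))
        -- With `w` as sole separator, `w` is a resolving involution, yet it lies outside `W`.
        ...     | no none = w∉W (from (W-resolvers w) (resolver⁻ (resolver iw single (only w≢x w≢y ne agreement))))
          where
          agreement : ∀ z → z ≢ x → z ≢ y → z ≢ w → c x z ≡ c y z
          agreement z z≢x z≢y z≢w with c x z Bool.≟ c y z
          ... | yes eq = eq
          ... | no ne′ = contradiction (z , z≢x , z≢y , z≢w , ne′) none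
        ...     | yes (w′ , w′≢x , w′≢y , w′≢w , ne′) with x ≟ ε | y ≟ ε | proj₁ (un w′ w′≢x w′≢y ne′) | c-≢ ne
        ...       | yes refl | yes refl | _ | _ = ¬x≈y ≈-refl
        ...       | yes refl | no y≢ε | _ | _ = ¬Ψ (universal y≢ε un w≢x w≢y w′≢x w′≢y ne ne′ (≢-sym w′≢w))
        ...       | no x≢ε | yes refl | _ | _ =
          ¬Ψ (universal x≢ε (unresolved-swap un) w≢y w≢x w′≢y w′≢x (≢-sym ne) (≢-sym ne′) (≢-sym w′≢w))
        ...       | no x≢ε | no y≢ε | iw′ | inj₁ (xw , ¬yw) =
          two-sided un x≢ε y≢ε w≢x w′≢x w′≢y iw iw′ (≢-sym w′≢w) xw ¬yw ne′
        ...       | no x≢ε | no y≢ε | iw′ | inj₂ (yw , ¬xw) =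
          two-sided (unresolved-swap un) y≢ε x≢ε w≢y w′≢y w′≢x iw iw′ (≢-sym w′≢w) yw ¬xw (≢-sym ne′)

    -- Groups in Ψ

    module _ {p : ℕ} (p-prime : Prime p) (p≢2 : p ≢ 2)
      (prime-divisors : ∀ q → Prime q → q ∣ n ⇔ (q ≡ 2 ⊎ q ≡ p))
      (unique-subgroup : UniqueSubgroupOfOrder G p)
      (no-order-4 : ∀ g → ¬ HasOrder G g 4)
      (involutions-in-2p : ∀ g → IsInvolution G g → ∃[ h ] (HasOrder G h (2 * p) × IsPowerOf G g h))
      where

      order-p : ∃[ x ] HasOrder G x p
      order-p with proj₁ unique-subgroup
      ... | H , sub , ∣H∣≡p = map₂ proj₂ (element-of-prime-subgroup p-prime sub ∣H∣≡p)

      order-p-≼ : ∀ {x y} → HasOrder G x p → HasOrder G y p → x ≼ y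
      order-p-≼ {x} {y} ox oy = ∈-fromDec⁻ (_≼? y) (subst (x ∈ₛ_)
        (proj₂ unique-subgroup ⟨ x ⟩ ⟨ y ⟩ (⟨⟩-subgroup x) (∣⟨⟩∣ ox) (⟨⟩-subgroup y) (∣⟨⟩∣ oy))
        (∈-fromDec⁺ (_≼? x) ≼-refl))

      -- If `p` does not divide the order of `g`, the only prime dividing it is 2. The order is
      -- neither 1 nor 2, so 4 divides it, against (C3). If `p` divides it, the unique subgroup of
      -- order `p` lies in ⟨g⟩.
      noninvolution-above-order-p : ∀ {x g} → HasOrder G x p → g ≢ ε → ¬ IsInvolution G g → x ≼ g
      noninvolution-above-order-p {x} {g} ox g≢ε ¬ig with order g
      ... | m , og with p ∣? m
      ...   | yes p∣m with element-of-order og p∣m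
      ...     | h , h≼g , oh = ≼-trans (order-p-≼ ox oh) h≼g
      noninvolution-above-order-p {x} {g} ox g≢ε ¬ig | m , og | no p∤m = contradiction (proj₂ order-4) (no-order-4 _)
        where
        only-2 : ∀ {q} → Prime q → q ∣ m → q ≡ 2
        only-2 q-prime q∣m with element-of-order og q∣m
        ... | h , _ , oh with to (prime-divisors _ q-prime) (prime-order∣n q-prime oh)
        ...   | inj₁ q≡2 = q≡2
        ...   | inj₂ refl = contradiction q∣m p∤m
        order-4 : ∃[ h ] HasOrder G h 4
        order-4 with prime-divisor m (order-≢0 og) (λ { refl → g≢ε (order-1 og) })
        ... | q , q-prime , q∣m with only-2 q-prime q∣m | q∣m
        ...   | refl | divides e refl with e ≟ℕ 1
        ...     | yes refl = contradiction og ¬ig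
        ...     | no e≢1 with prime-divisor e (λ { refl → order-≢0 og refl }) e≢1
        ...       | r , r-prime , r∣e with only-2 r-prime (∣m⇒∣m*n 2 r∣e)
        ...         | refl = map₂ proj₂ (element-of-order og (*-monoˡ-∣ 2 r∣e))

      -- Each kind of `v` is told from `s` by a specific vertex: ε and the non-involutions by an
      -- element `x` of order `p`, another involution by the element of order `2 * p` above `s`.
      involution-singleton : ∀ {s} → IsInvolution G s → Singleton s
      involution-singleton {s} is {v} s≈v with v ≟ s | v ≟ ε | involution? v | order-p
      ... | yes eq | _ | _ | _ = eq
      ... | no v≢s | yes refl | _ | x , ox = contradiction
              (comparable-sym (transfer (sym (s≈v x x≢s (prime-order-≢ε p-prime ox))) (ε-comparable x)))
              (odd-prime-¬comparable p-prime p≢2 ox is)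
        where
        x≢s : x ≢ s
        x≢s refl = odd-prime-¬involution p≢2 ox is
      ... | no v≢s | no v≢ε | yes iv | _ with involutions-in-2p s is
      ...   | h , oh , s≼h = unique-involution iv is (comparable-involution iv h≢ε h≢v (comparable-sym
                (transfer (s≈v h h≢s h≢v) (inj₂ s≼h)))) s≼h
        where
        h≢ε : h ≢ ε
        h≢ε = above-≢ε is s≼h
        h≢v : h ≢ v
        h≢v refl = 2p-¬involution p-prime oh iv
        h≢s : h ≢ s
        h≢s refl = 2p-¬involution p-prime oh is
      involution-singleton {s} is {v} s≈v | no v≢s | no v≢ε | no ¬iv | x , ox = contradiction xs
          (odd-prime-¬comparable p-prime p≢2 ox is)
        where
        x≢s : x ≢ s
        x≢s refl = odd-prime-¬involution p≢2 ox is
        xs : Comparable x s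
        xs with x ≟ v
        -- `s≈v` says nothing at `v` itself, so when `x` is `v` the test vertex is the inverse of
        -- `v`, supplied inside `agree⇒comparable`.
        ... | yes refl = comparable-sym (agree⇒comparable v≢ε ¬iv (λ z z≢v z≢s _ → sym (s≈v z z≢s z≢v)))
        ... | no x≢v = comparable-sym (transfer (sym (s≈v x x≢s x≢v)) (inj₁ (noninvolution-above-order-p ox v≢ε ¬iv)))

      -- If `S` misses a vertex in the class of ε and one in the class of `x`, the vertex of `S`
      -- separating these two is an involution, and that involution is its entire class.
      full-class : ∀ {S} → Resolving G S → ∃[ t ] (∀ v → t ≈ v → v ∈ₛ S)
      full-class {S} res with order-p
      ... | x , ox with missing⊎full S ε | missing⊎full S x
      ...   | inj₂ full | _ = ε , full
      ...   | inj₁ _ | inj₂ full = x , full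
      ...   | inj₁ (e , ε≈e , e∉S) | inj₁ (x′ , x≈x′ , x′∉S) with resolving-separates res e≢x′ e∉S x′∉S
        where
        -- Any involution, provided by Cauchy's theorem, is comparable to ε but not to `x`.
        e≢x′ : e ≢ x′
        e≢x′ refl with cauchy prime[2] (from (prime-divisors 2 prime[2]) (inj₁ refl))
        ... | w , iw = odd-prime-¬comparable p-prime p≢2 ox iw
          (transfer (≈-trans ε≈e (≈-sym x≈x′) w (involution-≢ε iw) (λ { refl → odd-prime-¬involution p≢2 ox iw })) (ε-comparable w))
      ...     | s , s∈S , s≢e , s≢x′ , ne = s , λ v s≈v → subst (_∈ₛ S) (sym (involution-singleton s-involution s≈v)) s∈S
        where
        e-universal : Comparable e s
        e-universal with s ≟ ε
        ... | yes refl = inj₁ (ε≼ e)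
        ... | no s≢ε = transfer (ε≈e s s≢ε s≢e) (ε-comparable s)
        ¬x′s : ¬ Comparable x′ s
        ¬x′s x′s = ne (trans (c⁺ e-universal) (sym (c⁺ x′s)))
        s≢ε : s ≢ ε
        s≢ε refl = ¬x′s (inj₁ (ε≼ x′))
        s≢x : s ≢ x
        s≢x refl = ¬x′s (agree⇒comparable (prime-order-≢ε p-prime ox) (odd-prime-¬involution p≢2 ox) (λ z a b _ → x≈x′ z a b))
        s-involution : IsInvolution G s
        s-involution with involution? s
        ... | yes is = is
        ... | no ¬is = contradiction (transfer (x≈x′ s s≢x s≢x′) (inj₂ (noninvolution-above-order-p ox s≢ε ¬is))) ¬x′s

      size-≥-1 : ∀ {S} → Resolving G S → n ∸ ∣ T ∣ + 1 ≤ ∣ S ∣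
      -- A single full class is counted, so any one-element list of labels will do.
      size-≥-1 {S} res = size-lower-bound res (ε ∷ []) ([] ∷ []) (λ _ x → ∀ v → x ≈ v → v ∈ₛ S)
        (λ _ → let (t , full) = full-class res in t , full , full)
        (λ { (here refl) (here refl) _ _ _ → refl })

      -- The vertices are nested with `b` below `a`, and `b` has odd prime order, which must be `p`.
      -- So `b` lies below an `h` of order `2 * p` above `v`. As `h` does not separate `a` and `b`,
      -- it is nested with `a`, and the larger of the two contains both `v` and `w`.
      unresolved-single : ∀ {a b w v} → a ≢ ε → b ≢ ε →
        (∀ z → z ≢ a → z ≢ b → c a z ≢ c b z → IsInvolution G z) →
        IsInvolution G w → w ≢ a → Comparable a w → ¬ Comparable b w →
        ¬ (IsInvolution G v × v ≢ w)
      unresolved-single {a} {b} {w} {v} a≢ε b≢ε un iw w≢a aw ¬bw (iv , v≢w) = conclude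
          (agree⇒comparable a≢ε (above-¬involution iw w≼a (≢-sym w≢a)) (λ z z≢a z≢b ¬iz → agreement z≢a z≢b ¬iz))
        where
        w≼a : w ≼ a
        w≼a = comparable-involution iw a≢ε (≢-sym w≢a) aw
        agreement : ∀ {z} → z ≢ a → z ≢ b → ¬ IsInvolution G z → c a z ≡ c b z
        agreement {z} z≢a z≢b ¬iz with c a z Bool.≟ c b z
        ... | yes eq = eq
        ... | no ne = contradiction (un z z≢a z≢b ne) ¬iz
        b-compares : b ≼ a → ∀ h → h ≼ a → ¬ IsInvolution G h → h ≢ b → Comparable b h
        b-compares b≼a h h≼a ¬ih h≢b with h ≟ a
        ... | yes refl = inj₂ b≼a
        ... | no h≢a = transfer (agreement h≢a h≢b ¬ih) (inj₁ h≼a)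
        conclude : ¬ Comparable b a
        conclude (inj₁ a≼b) = ¬bw (inj₁ (≼-trans w≼a a≼b))
        conclude (inj₂ b≼a) with order-is-odd-prime iw w≼a b≼a b≢ε (λ w≼b → ¬bw (inj₁ w≼b)) (b-compares b≼a)
        ... | r , r-prime , r≢2 , ob with to (prime-divisors r r-prime) (prime-order∣n r-prime ob)
        ...   | inj₁ r≡2 = r≢2 r≡2
        ...   | inj₂ refl with involutions-in-2p v iv
        ...     | h , oh , v≼h with transfer (sym (agreement h≢a h≢b (2p-¬involution p-prime oh))) (inj₂ b≼h)
          where
          v⋠a : ¬ v ≼ a
          v⋠a v≼a = v≢w (unique-involution iv iw v≼a w≼a)
          h≢a : h ≢ a
          h≢a refl = v⋠a v≼h
          h≢b : h ≢ b
          h≢b refl = v⋠a (≼-trans v≼h b≼a)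
          b≼h : b ≼ h
          b≼h = noninvolution-above-order-p ob (above-≢ε iv v≼h) (2p-¬involution p-prime oh)
        ...       | inj₁ h≼a = v≢w (unique-involution iv iw (≼-trans v≼h h≼a) w≼a)
        ...       | inj₂ a≼h = v≢w (unique-involution iv iw v≼h (≼-trans w≼a a≼h))

      -- With several involutions, adding the representative of ε leaves only pairs without ε, and
      -- `unresolved-single` excludes these. With one involution, only it could separate an
      -- unresolved pair, so that involution is added.
      resolving-by-one : ∃[ S ] (Resolving G S × ∣ S ∣ ≡ n ∸ ∣ T ∣ + 1)
      resolving-by-one with any? (λ v → any? (λ v′ → involution? v ×-dec involution? v′ ×-dec ¬? (v ≟ v′)))
      ... | yes (v , v′ , iv , iv′ , v≢v′) with representative ε
      ...   | e , e∈T , ε≈e = map₂ (map₂ (λ eq → trans eq (cong (n ∸ ∣ T ∣ +_) (∣⁅x⁆∣≡1 e))))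
                (resolving-by-adding ⁅ e ⁆ (λ x∈ → subst (_∈ₛ T) (sym (x∈⁅y⁆⇒x≡y e x∈)) e∈T) resolved)
        where
        another : ∀ w → ∃[ u ] (IsInvolution G u × u ≢ w)
        another w with v ≟ w
        ... | no v≢w = v , iv , v≢w
        ... | yes refl = v′ , iv′ , ≢-sym v≢v′
        ≢ε : ∀ {x} → x ∈ₛ T → x ∉ₛ ⁅ e ⁆ → x ≢ ε
        ≢ε x∈T x∉E refl = x∉E (subst (_∈ₛ ⁅ e ⁆) (sym (distinct x∈T e∈T ε≈e)) (x∈⁅x⁆ e))
        resolved : ∀ {x y} → x ∈ₛ T → y ∈ₛ T → x ∉ₛ ⁅ e ⁆ → y ∉ₛ ⁅ e ⁆ → ¬ x ≈ y → ¬ Unresolved ⁅ e ⁆ x y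
        resolved {x} {y} x∈T y∈T x∉E y∉E ¬x≈y un with differ x y
        ... | inj₁ x≈y = ¬x≈y x≈y
        ... | inj₂ (w , w≢x , w≢y , ne) with proj₁ (un w w≢x w≢y ne) | c-≢ ne
        ...   | iw | inj₁ (xw , ¬yw) = unresolved-single (≢ε x∈T x∉E) (≢ε y∈T y∉E)
                  (λ z z≢x z≢y ne → proj₁ (un z z≢x z≢y ne)) iw w≢x xw ¬yw (proj₂ (another w))
        ...   | iw | inj₂ (yw , ¬xw) = unresolved-single (≢ε y∈T y∉E) (≢ε x∈T x∉E)
                  (λ z z≢y z≢x ne → proj₁ (un z z≢x z≢y (≢-sym ne))) iw w≢y yw ¬xw (proj₂ (another w))
      resolving-by-one | no none with cauchy prime[2] (from (prime-divisors 2 prime[2]) (inj₁ refl))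
      ... | v , iv with representative v
      ...   | t , t∈T , v≈t = map₂ (map₂ (λ eq → trans eq (cong (n ∸ ∣ T ∣ +_) (∣⁅x⁆∣≡1 t))))
                (resolving-by-adding ⁅ t ⁆ (λ x∈ → subst (_∈ₛ T) (sym (x∈⁅y⁆⇒x≡y t x∈)) t∈T) resolved)
        where
        resolved : ∀ {x y} → x ∈ₛ T → y ∈ₛ T → x ∉ₛ ⁅ t ⁆ → y ∉ₛ ⁅ t ⁆ → ¬ x ≈ y → ¬ Unresolved ⁅ t ⁆ x y
        resolved {x} {y} _ _ _ _ ¬x≈y un with differ x y
        ... | inj₁ x≈y = ¬x≈y x≈y
        ... | inj₂ (w , w≢x , w≢y , ne) with un w w≢x w≢y ne | v ≟ w
        ...   | iw , _ , _ | no v≢w = none (v , w , iv , iw , v≢w)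
        ...   | _ , single , w∉E | yes refl = w∉E (subst (_∈ₛ ⁅ t ⁆) (single v≈t) (x∈⁅x⁆ t))

theorem3p26 : (n : ℕ) (G : FinGroup n) (u w : ℕ)
    → NumClasses G u → Card G (IsResolvingInvolution G) w
    → (InΨ G → IsMetricDim G (n ∸ u + 1))
    × (¬ InΨ G → IsMetricDim G (n ∸ u + w))
theorem3p26 n G u w (T , refl , rep , distinct) (W , W-resolvers , refl) =
  (λ (_ , p , p-prime , p≢2 , c1 , c2 , c3 , c4) →
    resolving-by-one tr p-prime p≢2 c1 c2 c3 c4 ,
    λ S res → size-≥-1 tr p-prime p≢2 c1 c2 c3 c4 res) ,
  (λ ¬Ψ → resolving-by-resolvers tr W-resolvers ¬Ψ , λ S res → size-≥-resolvers tr W-resolvers res)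
  where
  open Dimension G
  open Twins G using (twin⇒≈; ≈⇒twin)
  tr : Transversal T
  tr = transversal (λ x → map₂ (map₂ twin⇒≈) (rep x)) (λ s∈T t∈T s≈t → distinct _ _ s∈T t∈T (≈⇒twin s≈t))
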